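{- The sepr-sequences attained by $n\times n$ complex Hermitian matrices for $n=1,2,3$ are exactly the following. For $n=1$ (3 sequences): $\mathtt{A^+}$, $\mathtt{A^- }$, $\mathtt{N}$. For $n=2$ (13 sequences): $\mathtt{A^*A^- }$, $\mathtt{A^+A^+}$, $\mathtt{A^+A^- }$, $\mathtt{A^+N}$, $\mathtt{A^-A^+}$, $\mathtt{A^-A^- }$, $\mathtt{A^-N}$, $\mathtt{NA^- }$, $\mathtt{NN}$, $\mathtt{S^+A^- }$, $\mathtt{S^+N}$, $\mathtt{S^-A^- }$, $\mathtt{S^-N}$. For $n=3$ (65 sequences): $\mathtt{A^*A^*A^+}$, $\mathtt{A^*A^*A^- }$, $\mathtt{A^*A^-A^+}$, $\mathtt{A^*A^-A^- }$, $\mathtt{A^+A^*A^- }$, $\mathtt{A^+A^+A^+}$, $\mathtt{A^+A^+A^- }$, $\mathtt{A^+A^-A^+}$, $\mathtt{A^+A^-A^- }$, $\mathtt{A^-A^*A^+}$, $\mathtt{A^-A^+A^+}$, $\mathtt{A^-A^+A^- }$, $\mathtt{A^-A^-A^+}$, $\mathtt{A^-A^-A^- }$, $\mathtt{A^*A^-N}$, $\mathtt{A^+A^+N}$, $\mathtt{A^+A^-N}$, $\mathtt{A^-A^+N}$, $\mathtt{A^-A^-N}$, $\mathtt{A^+NA^- }$, $\mathtt{A^-NA^+}$, $\mathtt{A^+NN}$, $\mathtt{A^-NN}$, $\mathtt{A^*S^-A^+}$, $\mathtt{A^*S^-A^- }$, $\mathtt{A^+S^*A^- }$, $\mathtt{A^+S^+A^-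 }$, $\mathtt{A^+S^-A^- }$, $\mathtt{A^-S^*A^+}$, $\mathtt{A^-S^+A^+}$, $\mathtt{A^-S^-A^+}$, $\mathtt{A^*S^-N}$, $\mathtt{A^+S^+N}$, $\mathtt{A^+S^-N}$, $\mathtt{A^-S^+N}$, $\mathtt{A^-S^-N}$, $\mathtt{NA^-A^+}$, $\mathtt{NA^-A^- }$, $\mathtt{NA^-N}$, $\mathtt{NNN}$, $\mathtt{NS^-N}$, $\mathtt{S^*A^-A^+}$, $\mathtt{S^*A^-A^- }$, $\mathtt{S^+A^*A^- }$, $\mathtt{S^+A^-A^+}$, $\mathtt{S^+A^-A^- }$, $\mathtt{S^-A^*A^+}$, $\mathtt{S^-A^-A^+}$, $\mathtt{S^-A^-A^- }$, $\mathtt{S^*A^-N}$, $\mathtt{S^+A^-N}$, $\mathtt{S^-A^-N}$, $\mathtt{S^+NN}$, $\mathtt{S^-NN}$, $\mathtt{S^*S^-A^+}$, $\mathtt{S^*S^-A^- }$, $\mathtt{S^+S^*A^- }$, $\mathtt{S^+S^-A^- }$, $\mathtt{S^-S^*A^+}$, $\mathtt{S^-S^-A^+}$, $\mathtt{S^*S^-N}$, $\mathtt{S^+S^+N}$, $\mathtt{S^+S^-N}$, $\mathtt{S^-S^+N}$, $\mathtt{S^-S^-N}$.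
   Context: A principal minor of order $k$ of an $n\times n$ matrix is the determinant of a $k\times k$ principal submatrix (same row and column index set). The signed enhanced principal rank characteristic sequence (sepr-sequence) of an $n\times n$ complex Hermitian matrix $B$ is $\operatorname{sepr}(B)=t_1t_2\cdots t_n$, where: $t_k=\mathtt{A^*}$ if all order-$k$ principal minors are nonzero and there are both a positive and a negative one; $t_k=\mathtt{A^+}$ (resp. $\mathtt{A^- }$) if all order-$k$ principal minors are positive (resp. negative); $t_k=\mathtt{N}$ if all are zero; $t_k=\mathtt{S^*}$ if there are a positive, a negative and a zero order-$k$ principal minor; $t_k=\mathtt{S^+}$ (resp. $\mathtt{S^- }$) if there are both a zero and a nonzero order-$k$ principal minor, and every nonzero one is positive (resp. negative). A sequence of length $n$ is attained by a matrix $B$ if it equals $\operatorname{sepr}(B)$. -}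

module Defs where

open import Data.Bool.Base using (true; false)
open import Data.Fin.Base using (Fin; zero; suc; toℕ; punchIn)
open import Data.Fin.Subset using (Subset; ∣_∣)
open import Data.Nat.Base as ℕ using (ℕ; zero; suc)
import Data.Nat.Properties as ℕ
open import Data.Product.Base using (∃-syntax; _×_; _,_)
open import Data.Rational.Base as ℚ using (ℚ; 0ℚ; 1ℚ; ½)
import Data.Rational.Properties as ℚ
open import Data.Rational.Solver using (module +-*-Solver)
open import Data.Vec.Base using (Vec; []; _∷_; lookup)
import Data.Vec.Functional as Vector
open import Relation.Binary.PropositionalEquality using (_≡_; refl; sym; trans; cong; cong₂; subst)
open import Relation.Nullary.Negation.Core using (¬_)

------------------------------------------------------------------------
-- Real numbers: Cantor's construction, i.e. Cauchy sequences of
-- rationals, compared by the setoid equality _≈_ (the difference tends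
-- to 0) in place of a quotient.

IsCauchy : (ℕ → ℚ) → Set
IsCauchy x = ∀ ε → 0ℚ ℚ.< ε →
  ∃[ N ] (∀ m n → N ℕ.≤ m → N ℕ.≤ n → ℚ.∣ x m ℚ.- x n ∣ ℚ.< ε)

record ℝ : Set where
  constructor mkℝ
  field
    seq    : ℕ → ℚ
    cauchy : IsCauchy seq

open ℝ public

private abstract
  ½+½≡1 : ½ ℚ.+ ½ ≡ 1ℚ
  ½+½≡1 = refl

  halve : ∀ ε → ½ ℚ.* ε ℚ.+ ½ ℚ.* ε ≡ ε
  halve ε = trans (sym (ℚ.*-distribʳ-+ ε ½ ½))
    (trans (cong (ℚ._* ε) ½+½≡1) (ℚ.*-identityˡ ε))

  half-pos : ∀ {ε} → 0ℚ ℚ.< ε → 0ℚ ℚ.< ½ ℚ.* ε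
  half-pos {ε} 0<ε = subst (ℚ._< ½ ℚ.* ε) (ℚ.*-zeroʳ ½) (ℚ.*-monoʳ-<-pos ½ 0<ε)

  const-cauchy : ∀ q → IsCauchy (λ _ → q)
  const-cauchy q ε 0<ε = 0 , λ _ _ _ _ →
    subst (λ d → ℚ.∣ d ∣ ℚ.< ε) (sym (ℚ.+-inverseʳ q)) 0<ε

  +-cauchy : ∀ {x y} → IsCauchy x → IsCauchy y → IsCauchy (λ n → x n ℚ.+ y n)
  +-cauchy {x} {y} cx cy ε 0<ε with cx (½ ℚ.* ε) (half-pos 0<ε) | cy (½ ℚ.* ε) (half-pos 0<ε)
  ... | M , hx | N , hy = M ℕ.⊔ N , λ m n p q →
    let open ℚ.≤-Reasoning in begin-strict
    ℚ.∣ (x m ℚ.+ y m) ℚ.- (x n ℚ.+ y n) ∣      ≡⟨ cong ℚ.∣_∣ (rearrange (x m) (y m) (x n) (y n)) ⟩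
    ℚ.∣ (x m ℚ.- x n) ℚ.+ (y m ℚ.- y n) ∣      ≤⟨ ℚ.∣p+q∣≤∣p∣+∣q∣ (x m ℚ.- x n) (y m ℚ.- y n) ⟩
    ℚ.∣ x m ℚ.- x n ∣ ℚ.+ ℚ.∣ y m ℚ.- y n ∣    <⟨ ℚ.+-mono-<
                                                    (hx m n (ℕ.m⊔n≤o⇒m≤o M N p) (ℕ.m⊔n≤o⇒m≤o M N q))
                                                    (hy m n (ℕ.m⊔n≤o⇒n≤o M N p) (ℕ.m⊔n≤o⇒n≤o M N q)) ⟩
    ½ ℚ.* ε ℚ.+ ½ ℚ.* ε                        ≡⟨ halve ε ⟩
    ε                                          ∎
    where
    open +-*-Solver
    rearrange : ∀ a b c d → (a ℚ.+ b) ℚ.- (c ℚ.+ d) ≡ (a ℚ.- c) ℚ.+ (b ℚ.- d)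
    rearrange = solve 4 (λ a b c d → (a :+ b) :- (c :+ d) := (a :- c) :+ (b :- d)) refl

  neg-cauchy : ∀ {x} → IsCauchy x → IsCauchy (λ n → ℚ.- x n)
  neg-cauchy {x} cx ε 0<ε with cx ε 0<ε
  ... | N , h = N , λ m n p q → subst (ℚ._< ε) (flip m n) (h m n p q)
    where
    open +-*-Solver
    rearrange : ∀ a b → ℚ.- (a ℚ.- b) ≡ (ℚ.- a) ℚ.- (ℚ.- b)
    rearrange = solve 2 (λ a b → :- (a :- b) := (:- a) :- (:- b)) refl
    flip : ∀ m n → ℚ.∣ x m ℚ.- x n ∣ ≡ ℚ.∣ (ℚ.- x m) ℚ.- (ℚ.- x n) ∣
    flip m n = trans (sym (ℚ.∣-p∣≡∣p∣ (x m ℚ.- x n))) (cong ℚ.∣_∣ (rearrange (x m) (x n)))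

  eventually-bounded : ∀ {x} → IsCauchy x →
    ∃[ K ] 0ℚ ℚ.< K × ∃[ N ] (∀ n → N ℕ.≤ n → ℚ.∣ x n ∣ ℚ.≤ K)
  eventually-bounded {x} cx with cx 1ℚ (ℚ.positive⁻¹ 1ℚ)
  ... | N , h = 1ℚ ℚ.+ ℚ.∣ x N ∣
    , ℚ.+-mono-<-≤ (ℚ.positive⁻¹ 1ℚ) (ℚ.0≤∣p∣ (x N))
    , N , λ n p → let open ℚ.≤-Reasoning in begin
      ℚ.∣ x n ∣                          ≡⟨ cong ℚ.∣_∣ (split (x n) (x N)) ⟩
      ℚ.∣ (x n ℚ.- x N) ℚ.+ x N ∣        ≤⟨ ℚ.∣p+q∣≤∣p∣+∣q∣ (x n ℚ.- x N) (x N) ⟩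
      ℚ.∣ x n ℚ.- x N ∣ ℚ.+ ℚ.∣ x N ∣    ≤⟨ ℚ.+-monoˡ-≤ ℚ.∣ x N ∣ (ℚ.<⇒≤ (h n N p ℕ.≤-refl)) ⟩
      1ℚ ℚ.+ ℚ.∣ x N ∣                   ∎
    where
    open +-*-Solver
    split : ∀ a b → a ≡ (a ℚ.- b) ℚ.+ b
    split = solve 2 (λ a b → a := (a :- b) :+ b) refl

  divide : ∀ {K} ε → 0ℚ ℚ.< K → 0ℚ ℚ.< ε → ∃[ δ ] 0ℚ ℚ.< δ × K ℚ.* δ ≡ ε
  divide {K} ε 0<K 0<ε = (1/K ℚ.* ε) , pos , eq
    where
    instance
      K-pos : ℚ.Positive K
      K-pos = ℚ.positive 0<K
      K-nonZero : ℚ.NonZero K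
      K-nonZero = ℚ.pos⇒nonZero K
    1/K : ℚ
    1/K = ℚ.1/ K
    pos : 0ℚ ℚ.< 1/K ℚ.* ε
    pos = subst (ℚ._< 1/K ℚ.* ε) (ℚ.*-zeroʳ 1/K)
      (ℚ.*-monoʳ-<-pos 1/K ⦃ ℚ.1/pos⇒pos K ⦄ 0<ε)
    eq : K ℚ.* (1/K ℚ.* ε) ≡ ε
    eq = trans (sym (ℚ.*-assoc K 1/K ε))
      (trans (cong (ℚ._* ε) (ℚ.*-inverseʳ K)) (ℚ.*-identityˡ ε))

  *-bound : ∀ {p q K δ} → ℚ.∣ p ∣ ℚ.≤ K → ℚ.∣ q ∣ ℚ.< δ → 0ℚ ℚ.< K → ℚ.∣ p ℚ.* q ∣ ℚ.< K ℚ.* δ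
  *-bound {p} {q} {K} {δ} p≤K q<δ 0<K = let open ℚ.≤-Reasoning in begin-strict
    ℚ.∣ p ℚ.* q ∣          ≡⟨ ℚ.∣p*q∣≡∣p∣*∣q∣ p q ⟩
    ℚ.∣ p ∣ ℚ.* ℚ.∣ q ∣    ≤⟨ ℚ.*-monoʳ-≤-nonNeg ℚ.∣ q ∣ ⦃ ℚ.nonNegative (ℚ.0≤∣p∣ q) ⦄ p≤K ⟩
    K ℚ.* ℚ.∣ q ∣          <⟨ ℚ.*-monoʳ-<-pos K ⦃ ℚ.positive 0<K ⦄ q<δ ⟩
    K ℚ.* δ                ∎

  *-close : ∀ {K L δ η ε a b c d} → 0ℚ ℚ.< K → 0ℚ ℚ.< L →
    K ℚ.* η ≡ ½ ℚ.* ε → L ℚ.* δ ≡ ½ ℚ.* ε →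
    ℚ.∣ a ∣ ℚ.≤ K → ℚ.∣ d ∣ ℚ.≤ L → ℚ.∣ a ℚ.- c ∣ ℚ.< δ → ℚ.∣ b ℚ.- d ∣ ℚ.< η →
    ℚ.∣ a ℚ.* b ℚ.- c ℚ.* d ∣ ℚ.< ε
  *-close {K} {L} {δ} {η} {ε} {a} {b} {c} {d} 0<K 0<L Kη Lδ a≤K d≤L ac bd =
    let open ℚ.≤-Reasoning in begin-strict
    ℚ.∣ a ℚ.* b ℚ.- c ℚ.* d ∣                          ≡⟨ cong ℚ.∣_∣ (rearrange a b c d) ⟩
    ℚ.∣ d ℚ.* (a ℚ.- c) ℚ.+ a ℚ.* (b ℚ.- d) ∣          ≤⟨ ℚ.∣p+q∣≤∣p∣+∣q∣ (d ℚ.* (a ℚ.- c)) (a ℚ.* (b ℚ.- d)) ⟩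
    ℚ.∣ d ℚ.* (a ℚ.- c) ∣ ℚ.+ ℚ.∣ a ℚ.* (b ℚ.- d) ∣    <⟨ ℚ.+-mono-< (*-bound {d} d≤L ac 0<L) (*-bound {a} a≤K bd 0<K) ⟩
    L ℚ.* δ ℚ.+ K ℚ.* η                                ≡⟨ cong₂ ℚ._+_ Lδ Kη ⟩
    ½ ℚ.* ε ℚ.+ ½ ℚ.* ε                                ≡⟨ halve ε ⟩
    ε                                                  ∎
    where
    open +-*-Solver
    rearrange : ∀ a b c d → a ℚ.* b ℚ.- c ℚ.* d ≡ d ℚ.* (a ℚ.- c) ℚ.+ a ℚ.* (b ℚ.- d)
    rearrange = solve 4 (λ a b c d →
      (a :* b) :- (c :* d) := d :* (a :- c) :+ a :* (b :- d)) refl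

  *-cauchy : ∀ {x y} → IsCauchy x → IsCauchy y → IsCauchy (λ n → x n ℚ.* y n)
  *-cauchy {x} {y} cx cy ε 0<ε =
    let K , 0<K , M₁ , bx = eventually-bounded cx
        L , 0<L , M₂ , by = eventually-bounded cy
        δ , 0<δ , Lδ = divide (½ ℚ.* ε) 0<L (half-pos 0<ε)
        η , 0<η , Kη = divide (½ ℚ.* ε) 0<K (half-pos 0<ε)
        N₁ , hx = cx δ 0<δ
        N₂ , hy = cy η 0<η
        M = M₁ ℕ.⊔ M₂
        N = N₁ ℕ.⊔ N₂
    in M ℕ.⊔ N , λ m n p q →
      let pM = ℕ.m⊔n≤o⇒m≤o M N p
          pN = ℕ.m⊔n≤o⇒n≤o M N p
          qM = ℕ.m⊔n≤o⇒m≤o M N q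
          qN = ℕ.m⊔n≤o⇒n≤o M N q
      in *-close {a = x m} {y m} {x n} {y n} 0<K 0<L Kη Lδ
           (bx m (ℕ.m⊔n≤o⇒m≤o M₁ M₂ pM))
           (by n (ℕ.m⊔n≤o⇒n≤o M₁ M₂ qM))
           (hx m n (ℕ.m⊔n≤o⇒m≤o N₁ N₂ pN) (ℕ.m⊔n≤o⇒m≤o N₁ N₂ qN))
           (hy m n (ℕ.m⊔n≤o⇒n≤o N₁ N₂ pN) (ℕ.m⊔n≤o⇒n≤o N₁ N₂ qN))

fromℚ : ℚ → ℝ
fromℚ q = mkℝ (λ _ → q) (const-cauchy q)

0ℝ 1ℝ : ℝ
0ℝ = fromℚ 0ℚ
1ℝ = fromℚ 1ℚ

infix  8 -ℝ_
infixl 7 _*ℝ_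
infixl 6 _+ℝ_ _-ℝ_
infix  4 _≈ℝ_ _<ℝ_

_+ℝ_ _*ℝ_ : ℝ → ℝ → ℝ
x +ℝ y = mkℝ (λ n → seq x n ℚ.+ seq y n) (+-cauchy {seq x} {seq y} (cauchy x) (cauchy y))
x *ℝ y = mkℝ (λ n → seq x n ℚ.* seq y n) (*-cauchy {seq x} {seq y} (cauchy x) (cauchy y))

-ℝ_ : ℝ → ℝ
-ℝ x = mkℝ (λ n → ℚ.- seq x n) (neg-cauchy {seq x} (cauchy x))

_-ℝ_ : ℝ → ℝ → ℝ
x -ℝ y = x +ℝ (-ℝ y)

_≈ℝ_ : ℝ → ℝ → Set
x ≈ℝ y = ∀ ε → 0ℚ ℚ.< ε →
  ∃[ N ] (∀ n → N ℕ.≤ n → ℚ.∣ seq x n ℚ.- seq y n ∣ ℚ.< ε)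

_<ℝ_ : ℝ → ℝ → Set
x <ℝ y = ∃[ ε ] 0ℚ ℚ.< ε × ∃[ N ] (∀ n → N ℕ.≤ n → ε ℚ.< seq y n ℚ.- seq x n)

------------------------------------------------------------------------
-- Complex numbers

record ℂ : Set where
  constructor _+i_
  field
    re im : ℝ

open ℂ public

infix  8 -_
infixl 7 _*_
infixl 6 _+_
infix  4 _≈_

0ℂ 1ℂ : ℂ
0ℂ = 0ℝ +i 0ℝ
1ℂ = 1ℝ +i 0ℝ

_+_ _*_ : ℂ → ℂ → ℂ
z + w = (re z +ℝ re w) +i (im z +ℝ im w)
z * w = (re z *ℝ re w -ℝ im z *ℝ im w) +i (re z *ℝ im w +ℝ im z *ℝ re w)

-_ conj : ℂ → ℂ
- z = (-ℝ re z) +i (-ℝ im z)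
conj z = re z +i (-ℝ im z)

_≈_ : ℂ → ℂ → Set
z ≈ w = re z ≈ℝ re w × im z ≈ℝ im w

-- A complex number is positive (negative) when it is a real number that
-- is positive (negative).
Zero NonZero Positive Negative : ℂ → Set
Zero     z = z ≈ 0ℂ
NonZero  z = ¬ Zero z
Positive z = im z ≈ℝ 0ℝ × 0ℝ <ℝ re z
Negative z = im z ≈ℝ 0ℝ × re z <ℝ 0ℝ

------------------------------------------------------------------------
-- Matrices and principal minors

Matrix : ℕ → Set
Matrix n = Fin n → Fin n → ℂ

Hermitian : ∀ {n} → Matrix n → Set
Hermitian B = ∀ i j → B i j ≈ conj (B j i)

∑ : ∀ {n} → (Fin n → ℂ) → ℂ
∑ = Vector.foldr _+_ 0ℂ

-- (-1)ᵏ z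
alternate : ℕ → ℂ → ℂ
alternate zero    z = z
alternate (suc k) z = - alternate k z

-- Laplace expansion along the first row.
det : ∀ {n} → Matrix n → ℂ
det {zero}  M = 1ℂ
det {suc n} M = ∑ λ j →
  alternate (toℕ j) (M zero j * det (λ i k → M (suc i) (punchIn j k)))

-- The increasing enumeration of the elements of a subset.
element : ∀ {n} (α : Subset n) → Fin ∣ α ∣ → Fin n
element (true  ∷ α) zero    = zero
element (true  ∷ α) (suc i) = suc (element α i)
element (false ∷ α) i       = suc (element α i)

principalMinor : ∀ {n} → Matrix n → Subset n → ℂ
principalMinor B α = det λ i j → B (element α i) (element α j)

------------------------------------------------------------------------
-- Sepr-sequences

data SignSymbol : Set where
  A* A⁺ A⁻ N S* S⁺ S⁻ : SignSymbol

SignSequence : ℕ → Set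
SignSequence n = Vec SignSymbol n

module _ {n : ℕ} (B : Matrix n) (k : ℕ) where

  AllMinors SomeMinor : (ℂ → Set) → Set
  AllMinors P = ∀ (α : Subset n) → ∣ α ∣ ≡ k → P (principalMinor B α)
  SomeMinor P = ∃[ α ] ∣ α ∣ ≡ k × P (principalMinor B α)

  HasSymbol : SignSymbol → Set
  HasSymbol A* = AllMinors NonZero × SomeMinor Positive × SomeMinor Negative
  HasSymbol A⁺ = AllMinors Positive
  HasSymbol A⁻ = AllMinors Negative
  HasSymbol N  = AllMinors Zero
  HasSymbol S* = SomeMinor Positive × SomeMinor Negative × SomeMinor Zero
  HasSymbol S⁺ = SomeMinor Zero × SomeMinor NonZero × AllMinors (λ z → NonZero z → Positive z)
  HasSymbol S⁻ = SomeMinor Zero × SomeMinor NonZero × AllMinors (λ z → NonZero z → Negative z)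

-- "sepr(B) = t".  This is a relation rather than a function because the
-- sign of a real number is not computable.  The index k : Fin n counts
-- from 0, so position k describes the minors of order k + 1.
_HasSepr_ : ∀ {n} → Matrix n → SignSequence n → Set
B HasSepr t = ∀ k → HasSymbol B (suc (toℕ k)) (lookup t k)

Attained : ∀ {n} → SignSequence n → Set
Attained {n} t = ∃[ B ] Hermitian B × B HasSepr t

sequences₁ : Vec (SignSequence 1) 3
sequences₁ =
  (A⁺ ∷ []) ∷
  (A⁻ ∷ []) ∷
  (N ∷ []) ∷
  []

sequences₂ : Vec (SignSequence 2) 13
sequences₂ =
  (A* ∷ A⁻ ∷ []) ∷
  (A⁺ ∷ A⁺ ∷ []) ∷
  (A⁺ ∷ A⁻ ∷ []) ∷
  (A⁺ ∷ N ∷ []) ∷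
  (A⁻ ∷ A⁺ ∷ []) ∷
  (A⁻ ∷ A⁻ ∷ []) ∷
  (A⁻ ∷ N ∷ []) ∷
  (N ∷ A⁻ ∷ []) ∷
  (N ∷ N ∷ []) ∷
  (S⁺ ∷ A⁻ ∷ []) ∷
  (S⁺ ∷ N ∷ []) ∷
  (S⁻ ∷ A⁻ ∷ []) ∷
  (S⁻ ∷ N ∷ []) ∷
  []

sequences₃ : Vec (SignSequence 3) 65
sequences₃ =
  (A* ∷ A* ∷ A⁺ ∷ []) ∷
  (A* ∷ A* ∷ A⁻ ∷ []) ∷
  (A* ∷ A⁻ ∷ A⁺ ∷ []) ∷
  (A* ∷ A⁻ ∷ A⁻ ∷ []) ∷
  (A⁺ ∷ A* ∷ A⁻ ∷ []) ∷
  (A⁺ ∷ A⁺ ∷ A⁺ ∷ []) ∷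
  (A⁺ ∷ A⁺ ∷ A⁻ ∷ []) ∷
  (A⁺ ∷ A⁻ ∷ A⁺ ∷ []) ∷
  (A⁺ ∷ A⁻ ∷ A⁻ ∷ []) ∷
  (A⁻ ∷ A* ∷ A⁺ ∷ []) ∷
  (A⁻ ∷ A⁺ ∷ A⁺ ∷ []) ∷
  (A⁻ ∷ A⁺ ∷ A⁻ ∷ []) ∷
  (A⁻ ∷ A⁻ ∷ A⁺ ∷ []) ∷
  (A⁻ ∷ A⁻ ∷ A⁻ ∷ []) ∷
  (A* ∷ A⁻ ∷ N ∷ []) ∷
  (A⁺ ∷ A⁺ ∷ N ∷ []) ∷
  (A⁺ ∷ A⁻ ∷ N ∷ []) ∷
  (A⁻ ∷ A⁺ ∷ N ∷ []) ∷
  (A⁻ ∷ A⁻ ∷ N ∷ []) ∷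
  (A⁺ ∷ N ∷ A⁻ ∷ []) ∷
  (A⁻ ∷ N ∷ A⁺ ∷ []) ∷
  (A⁺ ∷ N ∷ N ∷ []) ∷
  (A⁻ ∷ N ∷ N ∷ []) ∷
  (A* ∷ S⁻ ∷ A⁺ ∷ []) ∷
  (A* ∷ S⁻ ∷ A⁻ ∷ []) ∷
  (A⁺ ∷ S* ∷ A⁻ ∷ []) ∷
  (A⁺ ∷ S⁺ ∷ A⁻ ∷ []) ∷
  (A⁺ ∷ S⁻ ∷ A⁻ ∷ []) ∷
  (A⁻ ∷ S* ∷ A⁺ ∷ []) ∷
  (A⁻ ∷ S⁺ ∷ A⁺ ∷ []) ∷
  (A⁻ ∷ S⁻ ∷ A⁺ ∷ []) ∷
  (A* ∷ S⁻ ∷ N ∷ []) ∷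
  (A⁺ ∷ S⁺ ∷ N ∷ []) ∷
  (A⁺ ∷ S⁻ ∷ N ∷ []) ∷
  (A⁻ ∷ S⁺ ∷ N ∷ []) ∷
  (A⁻ ∷ S⁻ ∷ N ∷ []) ∷
  (N ∷ A⁻ ∷ A⁺ ∷ []) ∷
  (N ∷ A⁻ ∷ A⁻ ∷ []) ∷
  (N ∷ A⁻ ∷ N ∷ []) ∷
  (N ∷ N ∷ N ∷ []) ∷
  (N ∷ S⁻ ∷ N ∷ []) ∷
  (S* ∷ A⁻ ∷ A⁺ ∷ []) ∷
  (S* ∷ A⁻ ∷ A⁻ ∷ []) ∷
  (S⁺ ∷ A* ∷ A⁻ ∷ []) ∷
  (S⁺ ∷ A⁻ ∷ A⁺ ∷ []) ∷
  (S⁺ ∷ A⁻ ∷ A⁻ ∷ []) ∷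
  (S⁻ ∷ A* ∷ A⁺ ∷ []) ∷
  (S⁻ ∷ A⁻ ∷ A⁺ ∷ []) ∷
  (S⁻ ∷ A⁻ ∷ A⁻ ∷ []) ∷
  (S* ∷ A⁻ ∷ N ∷ []) ∷
  (S⁺ ∷ A⁻ ∷ N ∷ []) ∷
  (S⁻ ∷ A⁻ ∷ N ∷ []) ∷
  (S⁺ ∷ N ∷ N ∷ []) ∷
  (S⁻ ∷ N ∷ N ∷ []) ∷
  (S* ∷ S⁻ ∷ A⁺ ∷ []) ∷
  (S* ∷ S⁻ ∷ A⁻ ∷ []) ∷
  (S⁺ ∷ S* ∷ A⁻ ∷ []) ∷
  (S⁺ ∷ S⁻ ∷ A⁻ ∷ []) ∷
  (S⁻ ∷ S* ∷ A⁺ ∷ []) ∷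
  (S⁻ ∷ S⁻ ∷ A⁺ ∷ []) ∷
  (S* ∷ S⁻ ∷ N ∷ []) ∷
  (S⁺ ∷ S⁺ ∷ N ∷ []) ∷
  (S⁺ ∷ S⁻ ∷ N ∷ []) ∷
  (S⁻ ∷ S⁺ ∷ N ∷ []) ∷
  (S⁻ ∷ S⁻ ∷ N ∷ []) ∷
  []

{-# OPTIONS --safe #-}

-- Write B as [[a, x, y], [x̄, b, z], [ȳ, z̄, c]].  Its minors satisfy
--   ab − |x|² ≤ ab,
--   a det B = (ab − |x|²)(ac − |y|²) − |az − x̄y|²,
--   det B = b (ac − |y|²)  if a = 0 and ab − |x|² = 0 (since then x = 0),
-- and the same after cyclic permutations of the indices.  The resulting conditions on
-- the seven signs admit only the listed sequences, and each of these is attained by a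
-- matrix of Gaussian integers.  The signs of real numbers are undecidable, but
-- membership in the list is decidable, so for necessity one may assume them known.

module Submission where

open import Defs
import Agda.Builtin.FromNat as FromNat
import Agda.Builtin.FromNeg as FromNeg
open import Data.Bool.Base using (Bool; true; false)
import Data.Bool.Properties as Bool
open import Data.Fin.Base using (Fin; zero; suc; toℕ; punchIn)
open import Data.Fin.Subset using (Subset; ∣_∣; ⊥)
open import Data.Fin.Subset.Properties using (anySubset?; ∣p∣≤n; ∣⊥∣≡0)
open import Data.Integer.Base as ℤ using (ℤ; +_; -[1+_])
open import Data.Nat.Base as ℕ using (ℕ; zero; suc)
import Data.Nat.Properties as ℕ
open import Data.Product.Base using (∃-syntax; _×_; _,_; proj₁; proj₂)
import Data.Product.Properties as Product
open import Data.Rational.Base as ℚ using (ℚ; 0ℚ; 1ℚ; ½; mkℚ)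
import Data.Rational.Literals as ℚ
import Data.Rational.Properties as ℚ
open import Data.Rational.Solver using (module +-*-Solver)
open import Data.Sum.Base using (_⊎_; inj₁; inj₂)
open import Data.Unit.Base using (⊤)
open import Data.Vec.Base as Vec using (Vec; []; _∷_; lookup; tabulate)
import Data.Vec.Functional as Vector
import Data.Vec.Membership.DecPropositional as DecMembership
open import Data.Vec.Membership.Propositional using (_∈_)
open import Data.Vec.Properties using (tabulate∘lookup; lookup∘tabulate; tabulate-cong; ≡-dec)
open import Data.Vec.Relation.Unary.AllPairs using (allPairs?)
open import Data.Vec.Relation.Unary.Any using (here; there)
open import Data.Vec.Relation.Unary.Unique.Propositional using (Unique)
open import Function.Base using (_∘_)
open import Function.Bundles using (_⇔_; mk⇔)
open import Relation.Binary.Definitions using (DecidableEquality)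
open import Relation.Binary.PropositionalEquality
  using (_≡_; _≢_; refl; sym; trans; cong; cong₂; subst; _≗_)
open import Relation.Nullary using (Dec; yes; no; does; proof; Reflects; ofʸ; ofⁿ)
open import Relation.Nullary.Decidable using (map′; _×-dec_; _→-dec_; ¬?; from-yes; decidable-stable)
open import Relation.Nullary.Negation.Core using (¬_; contradiction)
import Relation.Nullary.Reflects as Reflects
open import Relation.Unary using (Decidable)

open +-*-Solver using (Polynomial; solve; con; _:+_; _:*_; _:-_; :-_; _:=_)

-- Null and eventually positive sequences

-- The reals are handled through their rational sequences. Every identity between minors is
-- polynomial in the real and imaginary parts of the entries, so the ring solver proves it at each
-- index, and both inequalities arise by dropping a sum of two squares from such an identity. Limits
-- enter when these facts are passed on to signs, and in the degenerate case, where |x|² → 0 has to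
-- give x → 0. That case is essential: if the diagonal and all minors of order two vanish, the two
-- inequalities hold for every sign of the determinant and would let `N ∷ N ∷ A⁺ ∷ []` through. The
-- conditions need not characterize the attainable tuples of seven signs; it is enough that each
-- tuple satisfying them yields a listed sequence.

Null EventuallyPositive : (ℕ → ℚ) → Set
Null u = ∀ ε → 0ℚ ℚ.< ε → ∃[ L ] (∀ n → L ℕ.≤ n → ℚ.∣ u n ∣ ℚ.< ε)
EventuallyPositive u = ∃[ ε ] 0ℚ ℚ.< ε × ∃[ L ] (∀ n → L ℕ.≤ n → ε ℚ.< u n)

halve : ∀ ε → ½ ℚ.* ε ℚ.+ ½ ℚ.* ε ≡ ε
halve = solve 1 (λ ε → con ½ :* ε :+ con ½ :* ε := ε) refl

half-positive : ∀ {ε} → 0ℚ ℚ.< ε → 0ℚ ℚ.< ½ ℚ.* ε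
half-positive = ℚ.*-monoʳ-<-pos ½

half< : ∀ {ε} → 0ℚ ℚ.< ε → ½ ℚ.* ε ℚ.< ε
half< {ε} 0<ε = subst (½ ℚ.* ε ℚ.<_) (ℚ.*-identityˡ ε)
  (ℚ.*-monoˡ-<-pos ε ⦃ ℚ.positive 0<ε ⦄ (from-yes (½ ℚ.<? 1ℚ)))

p≤∣p∣ : ∀ p → p ℚ.≤ ℚ.∣ p ∣
p≤∣p∣ p with ℚ.≤-total 0ℚ p
... | inj₁ 0≤p = ℚ.≤-reflexive (sym (ℚ.0≤p⇒∣p∣≡p 0≤p))
... | inj₂ p≤0 = ℚ.≤-trans p≤0 (ℚ.0≤∣p∣ p)

0≤p*p : ∀ p → 0ℚ ℚ.≤ p ℚ.* p
0≤p*p p = subst (0ℚ ℚ.≤_) ∣p∣*∣p∣≡p*p (ℚ.nonNegative⁻¹ (ℚ.∣ p ∣ ℚ.* ℚ.∣ p ∣)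
  ⦃ ℚ.nonNeg*nonNeg⇒nonNeg ℚ.∣ p ∣ ⦃ ℚ.∣-∣-nonNeg p ⦄ ℚ.∣ p ∣ ⦃ ℚ.∣-∣-nonNeg p ⦄ ⦄)
  where
  ∣p∣*∣p∣≡p*p : ℚ.∣ p ∣ ℚ.* ℚ.∣ p ∣ ≡ p ℚ.* p
  ∣p∣*∣p∣≡p*p with ℚ.∣p∣≡p∨∣p∣≡-p p
  ... | inj₁ eq rewrite eq = refl
  ... | inj₂ eq rewrite eq = solve 1 (λ p → :- p :* :- p := p :* p) refl p

module _ {u v : ℕ → ℚ} where

  Null-dominated : (∀ n → ℚ.∣ v n ∣ ℚ.≤ ℚ.∣ u n ∣) → Null u → Null v
  Null-dominated ∣v∣≤∣u∣ u→0 ε 0<ε with u→0 ε 0<ε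
  ... | L , h = L , λ n L≤n → ℚ.≤-<-trans (∣v∣≤∣u∣ n) (h n L≤n)

  Null-cong : u ≗ v → Null u → Null v
  Null-cong u≗v = Null-dominated λ n → ℚ.≤-reflexive (cong ℚ.∣_∣ (sym (u≗v n)))

  Null-+ : Null u → Null v → Null (λ n → u n ℚ.+ v n)
  Null-+ u→0 v→0 ε 0<ε with u→0 (½ ℚ.* ε) (half-positive 0<ε) | v→0 (½ ℚ.* ε) (half-positive 0<ε)
  ... | M , hu | L , hv = M ℕ.⊔ L , λ n p → subst (ℚ.∣ u n ℚ.+ v n ∣ ℚ.<_) (halve ε)
    (ℚ.≤-<-trans (ℚ.∣p+q∣≤∣p∣+∣q∣ (u n) (v n))
      (ℚ.+-mono-< (hu n (ℕ.m⊔n≤o⇒m≤o M L p)) (hv n (ℕ.m⊔n≤o⇒n≤o M L p))))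

  -- Far out |v| < ε², so |u| ≥ ε would give ε² ≤ u² ≤ v < ε². With `v` the sequence of |x|², this
  -- makes both parts of x vanish.
  Null-sqrt : (∀ n → u n ℚ.* u n ℚ.≤ v n) → Null v → Null u
  Null-sqrt u²≤v v→0 ε 0<ε with v→0 (ε ℚ.* ε) 0<ε²
    where
    0<ε² : 0ℚ ℚ.< ε ℚ.* ε
    0<ε² = subst (ℚ._< ε ℚ.* ε) (ℚ.*-zeroʳ ε) (ℚ.*-monoʳ-<-pos ε ⦃ ℚ.positive 0<ε ⦄ 0<ε)
  ... | L , h = L , λ n p → ℚ.≰⇒> λ ε≤∣u∣ → ℚ.<-irrefl refl (let open ℚ.≤-Reasoning in begin-strict
    ε ℚ.* ε                      ≤⟨ ℚ.*-monoˡ-≤-nonNeg ε ⦃ ℚ.nonNegative (ℚ.<⇒≤ 0<ε) ⦄ ε≤∣u∣ ⟩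
    ε ℚ.* ℚ.∣ u n ∣              ≤⟨ ℚ.*-monoʳ-≤-nonNeg ℚ.∣ u n ∣ ⦃ ℚ.∣-∣-nonNeg (u n) ⦄ ε≤∣u∣ ⟩
    ℚ.∣ u n ∣ ℚ.* ℚ.∣ u n ∣      ≡⟨ ℚ.∣p*q∣≡∣p∣*∣q∣ (u n) (u n) ⟨
    ℚ.∣ u n ℚ.* u n ∣            ≡⟨ ℚ.0≤p⇒∣p∣≡p (0≤p*p (u n)) ⟩
    u n ℚ.* u n                  ≤⟨ u²≤v n ⟩
    v n                          ≤⟨ p≤∣p∣ (v n) ⟩
    ℚ.∣ v n ∣                    <⟨ h n p ⟩
    ε ℚ.* ε                      ∎)

  EventuallyPositive-mono : (∀ n → u n ℚ.≤ v n) → EventuallyPositive u → EventuallyPositive v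
  EventuallyPositive-mono u≤v (ε , 0<ε , L , h) =
    ε , 0<ε , L , λ n p → ℚ.<-≤-trans (h n p) (u≤v n)

  EventuallyPositive-* : EventuallyPositive u → EventuallyPositive v →
    EventuallyPositive (λ n → u n ℚ.* v n)
  EventuallyPositive-* (ε , 0<ε , M , hu) (η , 0<η , L , hv) =
    ε ℚ.* η , subst (ℚ._< ε ℚ.* η) (ℚ.*-zeroʳ ε) (ℚ.*-monoʳ-<-pos ε ⦃ ℚ.positive 0<ε ⦄ 0<η) ,
    M ℕ.⊔ L , λ n p → let u>ε = hu n (ℕ.m⊔n≤o⇒m≤o M L p) in ℚ.<-trans
      (ℚ.*-monoˡ-<-pos η ⦃ ℚ.positive 0<η ⦄ u>ε)
      (ℚ.*-monoʳ-<-pos (u n) ⦃ ℚ.positive (ℚ.<-trans 0<ε u>ε) ⦄ (hv n (ℕ.m⊔n≤o⇒n≤o M L p)))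

  -- Once the difference is below ε/2, half of the margin ε of `u` is left for `v`.
  EventuallyPositive-resp-Null : Null (λ n → u n ℚ.- v n) →
    EventuallyPositive u → EventuallyPositive v
  EventuallyPositive-resp-Null d→0 (ε , 0<ε , M , hu) with d→0 (½ ℚ.* ε) (half-positive 0<ε)
  ... | L , hd = ½ ℚ.* ε , half-positive 0<ε , M ℕ.⊔ L , λ n p → let open ℚ.≤-Reasoning in begin-strict
    ½ ℚ.* ε                                    ≡⟨ rearrange ε ⟩
    ε ℚ.- ½ ℚ.* ε                              <⟨ ℚ.+-mono-< (hu n (ℕ.m⊔n≤o⇒m≤o M L p)) (ℚ.neg-antimono-<
                                                    (ℚ.≤-<-trans (p≤∣p∣ _) (hd n (ℕ.m⊔n≤o⇒n≤o M L p)))) ⟩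
    u n ℚ.- (u n ℚ.- v n)                      ≡⟨ cancel (u n) (v n) ⟩
    v n                                        ∎
    where
    rearrange : ∀ ε → ½ ℚ.* ε ≡ ε ℚ.- ½ ℚ.* ε
    rearrange = solve 1 (λ ε → con ½ :* ε := ε :- con ½ :* ε) refl
    cancel : ∀ a b → a ℚ.- (a ℚ.- b) ≡ b
    cancel = solve 2 (λ a b → a :- (a :- b) := b) refl

Null-neg : ∀ {u} → Null u → Null (λ n → ℚ.- u n)
Null-neg {u} = Null-dominated λ n → ℚ.≤-reflexive (ℚ.∣-p∣≡∣p∣ (u n))

Null-const0 : Null (λ _ → 0ℚ)
Null-const0 ε 0<ε = 0 , λ _ _ → 0<ε

Null⇒¬EventuallyPositive : ∀ {u} → Null u → ¬ EventuallyPositive u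
Null⇒¬EventuallyPositive {u} u→0 (ε , 0<ε , M , hu) with u→0 ε 0<ε
... | L , h = ℚ.<-asym (hu n (ℕ.m≤m⊔n M L)) (ℚ.≤-<-trans (p≤∣p∣ (u n)) (h n (ℕ.m≤n⊔m M L)))
  where n = M ℕ.⊔ L

¬EventuallyPositive-both : ∀ {u} → EventuallyPositive u → ¬ EventuallyPositive (λ n → ℚ.- u n)
¬EventuallyPositive-both {u} (ε , 0<ε , M , h) (η , 0<η , L , h′) =
  ℚ.<-asym (ℚ.<-trans 0<ε (h n (ℕ.m≤m⊔n M L)))
    (subst (ℚ._< 0ℚ) (neg-involutive (u n)) (ℚ.neg-antimono-< (ℚ.<-trans 0<η (h′ n (ℕ.m≤n⊔m M L)))))
  where
  n = M ℕ.⊔ L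
  neg-involutive : ∀ p → ℚ.- (ℚ.- p) ≡ p
  neg-involutive = solve 1 (λ p → :- (:- p) := p) refl

-- A Cauchy sequence is bounded.
Null-* : ∀ (x : ℝ) {v} → Null v → Null (λ n → seq x n ℚ.* v n)
Null-* x {v} v→0 ε 0<ε with cauchy x 1ℚ (ℚ.positive⁻¹ 1ℚ)
... | M , hx = bound (v→0 (1/K ℚ.* ε) 0<δ)
  where
  K = 1ℚ ℚ.+ ℚ.∣ seq x M ∣
  0<K : 0ℚ ℚ.< K
  0<K = ℚ.+-mono-<-≤ (ℚ.positive⁻¹ 1ℚ) (ℚ.0≤∣p∣ (seq x M))
  instance
    K-positive : ℚ.Positive K
    K-positive = ℚ.positive 0<K
    K-nonZero : ℚ.NonZero K
    K-nonZero = ℚ.pos⇒nonZero K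
  1/K = ℚ.1/ K
  0<δ : 0ℚ ℚ.< 1/K ℚ.* ε
  0<δ = subst (ℚ._< 1/K ℚ.* ε) (ℚ.*-zeroʳ 1/K) (ℚ.*-monoʳ-<-pos 1/K ⦃ ℚ.1/pos⇒pos K ⦄ 0<ε)
  K*δ≡ε : K ℚ.* (1/K ℚ.* ε) ≡ ε
  K*δ≡ε = trans (sym (ℚ.*-assoc K 1/K ε))
    (trans (cong (ℚ._* ε) (ℚ.*-inverseʳ K)) (ℚ.*-identityˡ ε))
  split : ∀ a b → a ≡ (a ℚ.- b) ℚ.+ b
  split = solve 2 (λ a b → a := (a :- b) :+ b) refl
  bound : ∃[ L ] (∀ n → L ℕ.≤ n → ℚ.∣ v n ∣ ℚ.< 1/K ℚ.* ε) →
          ∃[ L ] (∀ n → L ℕ.≤ n → ℚ.∣ seq x n ℚ.* v n ∣ ℚ.< ε)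
  bound (L , hv) = M ℕ.⊔ L , λ n p → let open ℚ.≤-Reasoning in begin-strict
    ℚ.∣ seq x n ℚ.* v n ∣                      ≡⟨ ℚ.∣p*q∣≡∣p∣*∣q∣ (seq x n) (v n) ⟩
    ℚ.∣ seq x n ∣ ℚ.* ℚ.∣ v n ∣                ≡⟨ cong (λ p → ℚ.∣ p ∣ ℚ.* ℚ.∣ v n ∣) (split (seq x n) (seq x M)) ⟩
    ℚ.∣ (seq x n ℚ.- seq x M) ℚ.+ seq x M ∣ ℚ.* ℚ.∣ v n ∣
      ≤⟨ ℚ.*-monoʳ-≤-nonNeg ℚ.∣ v n ∣ ⦃ ℚ.∣-∣-nonNeg (v n) ⦄
           (ℚ.≤-trans (ℚ.∣p+q∣≤∣p∣+∣q∣ (seq x n ℚ.- seq x M) (seq x M))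
             (ℚ.+-monoˡ-≤ ℚ.∣ seq x M ∣ (ℚ.<⇒≤ (hx n M (ℕ.m⊔n≤o⇒m≤o M L p) ℕ.≤-refl)))) ⟩
    K ℚ.* ℚ.∣ v n ∣                            <⟨ ℚ.*-monoʳ-<-pos K (hv n (ℕ.m⊔n≤o⇒n≤o M L p)) ⟩
    K ℚ.* (1/K ℚ.* ε)                          ≡⟨ K*δ≡ε ⟩
    ε                                          ∎

-- Congruence of the operations

-- The bridge from solver identities, which hold index by index, to equality of reals.
≗⇒≈ℝ : ∀ {x y} → seq x ≗ seq y → x ≈ℝ y
≗⇒≈ℝ {x} {y} x≗y = Null-cong (λ n → sym (trans (cong (ℚ._- seq y n) (x≗y n)) (ℚ.+-inverseʳ (seq y n)))) Null-const0

≈ℝ-refl : ∀ {x} → x ≈ℝ x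
≈ℝ-refl {x} = ≗⇒≈ℝ {x} {x} λ _ → refl

≈ℝ-trans : ∀ {x y z} → x ≈ℝ y → y ≈ℝ z → x ≈ℝ z
≈ℝ-trans {x} {y} {z} x≈y y≈z =
  Null-cong (λ n → lemma (seq x n) (seq y n) (seq z n)) (Null-+ x≈y y≈z)
  where
  lemma : ∀ a b c → (a ℚ.- b) ℚ.+ (b ℚ.- c) ≡ a ℚ.- c
  lemma = solve 3 (λ a b c → (a :- b) :+ (b :- c) := a :- c) refl

-ℝ-cong : ∀ {x y} → x ≈ℝ y → -ℝ x ≈ℝ -ℝ y
-ℝ-cong {x} {y} x≈y = Null-cong (λ n → lemma (seq x n) (seq y n)) (Null-neg x≈y)
  where
  lemma : ∀ a b → ℚ.- (a ℚ.- b) ≡ (ℚ.- a) ℚ.- (ℚ.- b)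
  lemma = solve 2 (λ a b → :- (a :- b) := :- a :- :- b) refl

module _ {x y z w : ℝ} (x≈y : x ≈ℝ y) (z≈w : z ≈ℝ w) where

  +ℝ-cong : x +ℝ z ≈ℝ y +ℝ w
  +ℝ-cong = Null-cong (λ n → lemma (seq x n) (seq y n) (seq z n) (seq w n)) (Null-+ x≈y z≈w)
    where
    lemma : ∀ a b c d → (a ℚ.- b) ℚ.+ (c ℚ.- d) ≡ (a ℚ.+ c) ℚ.- (b ℚ.+ d)
    lemma = solve 4 (λ a b c d → (a :- b) :+ (c :- d) := (a :+ c) :- (b :+ d)) refl

  *ℝ-cong : x *ℝ z ≈ℝ y *ℝ w
  *ℝ-cong = Null-cong (λ n → lemma (seq x n) (seq y n) (seq z n) (seq w n))
    (Null-+ (Null-* z x≈y) (Null-* y z≈w))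
    where
    lemma : ∀ a b c d → c ℚ.* (a ℚ.- b) ℚ.+ b ℚ.* (c ℚ.- d) ≡ a ℚ.* c ℚ.- b ℚ.* d
    lemma = solve 4 (λ a b c d → c :* (a :- b) :+ b :* (c :- d) := a :* c :- b :* d) refl

≈-refl : ∀ {z} → z ≈ z
≈-refl {z} = ≈ℝ-refl {re z} , ≈ℝ-refl {im z}

neg-cong : ∀ {z w} → z ≈ w → - z ≈ - w
neg-cong {z} {w} (p , q) = -ℝ-cong {re z} {re w} p , -ℝ-cong {im z} {im w} q

module _ {x y z w : ℂ} (x≈y : x ≈ y) (z≈w : z ≈ w) where
  private
    re-x≈y = proj₁ x≈y
    im-x≈y = proj₂ x≈y
    re-z≈w = proj₁ z≈w
    im-z≈w = proj₂ z≈w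

  +-cong : x + z ≈ y + w
  +-cong = +ℝ-cong {re x} {re y} {re z} {re w} re-x≈y re-z≈w
         , +ℝ-cong {im x} {im y} {im z} {im w} im-x≈y im-z≈w

  *-cong : x * z ≈ y * w
  *-cong = +ℝ-cong {re x *ℝ re z} {re y *ℝ re w} { -ℝ (im x *ℝ im z)} { -ℝ (im y *ℝ im w)}
             (*ℝ-cong {re x} {re y} {re z} {re w} re-x≈y re-z≈w)
             (-ℝ-cong {im x *ℝ im z} {im y *ℝ im w} (*ℝ-cong {im x} {im y} {im z} {im w} im-x≈y im-z≈w))
         , +ℝ-cong {re x *ℝ im z} {re y *ℝ im w} {im x *ℝ re z} {im y *ℝ re w}
             (*ℝ-cong {re x} {re y} {im z} {im w} re-x≈y im-z≈w)
             (*ℝ-cong {im x} {im y} {re z} {re w} im-x≈y re-z≈w)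

∑-cong : ∀ {n} (f g : Fin n → ℂ) → (∀ i → f i ≈ g i) → ∑ f ≈ ∑ g
∑-cong {zero}  f g f≈g = ≈-refl {0ℂ}
∑-cong {suc n} f g f≈g =
  +-cong {f zero} {g zero} {∑ (f ∘ suc)} {∑ (g ∘ suc)} (f≈g zero) (∑-cong (f ∘ suc) (g ∘ suc) (f≈g ∘ suc))

alternate-cong : ∀ k z w → z ≈ w → alternate k z ≈ alternate k w
alternate-cong zero    z w z≈w = z≈w
alternate-cong (suc k) z w z≈w = neg-cong {alternate k z} {alternate k w} (alternate-cong k z w z≈w)

det-cong : ∀ {n} (M M′ : Matrix n) → (∀ i j → M i j ≈ M′ i j) → det M ≈ det M′
det-cong {zero}  M M′ M≈M′ = ≈-refl {1ℂ}
det-cong {suc n} M M′ M≈M′ = ∑-cong (summand M) (summand M′) λ j → alternate-cong (toℕ j) (term M j) (term M′ j)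
  (*-cong {M zero j} {M′ zero j} {cofactor M j} {cofactor M′ j} (M≈M′ zero j)
    (det-cong (submatrix M j) (submatrix M′ j) λ i k → M≈M′ (suc i) (punchIn j k)))
  where
  submatrix : Matrix (suc n) → Fin (suc n) → Matrix n
  submatrix M j i k = M (suc i) (punchIn j k)
  cofactor term summand : Matrix (suc n) → Fin (suc n) → ℂ
  cofactor M j = det (submatrix M j)
  term M j = M zero j * cofactor M j
  summand M j = alternate (toℕ j) (term M j)

-- Signs

data Sgn : Set where
  neg zer pos : Sgn

-- Transports order, antisymmetry and decidable equality from ℕ to signs.
rank : Sgn → ℕ
rank neg = 0
rank zer = 1
rank pos = 2

rank-injective : ∀ s t → rank s ≡ rank t → s ≡ t
rank-injective neg neg _ = refl
rank-injective zer zer _ = refl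
rank-injective pos pos _ = refl

infix 4 _⊑_
_⊑_ : Sgn → Sgn → Set
s ⊑ t = rank s ℕ.≤ rank t

infixl 7 _·_
_·_ : Sgn → Sgn → Sgn
neg · neg = pos
neg · zer = zer
neg · pos = neg
zer · _   = zer
pos · t   = t

-- The sign predicates on ℂ without the subtraction of 0 and the condition on the imaginary part, so
-- that solver identities apply directly to the sequence.
HasSign : Sgn → ℝ → Set
HasSign neg x = EventuallyPositive (ℚ.-_ ∘ seq x)
HasSign zer x = Null (seq x)
HasSign pos x = EventuallyPositive (seq x)

-- This turns an inequality between minors into a condition on their signs. The termwise hypothesis
-- is what dropping squares provides. Comparing a real with itself both ways also gives uniqueness
-- of its sign.
HasSign-mono : ∀ s t x y → (∀ n → seq x n ℚ.≤ seq y n) → HasSign s x → HasSign t y → s ⊑ t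
HasSign-mono neg t   x y x≤y hx hy = ℕ.z≤n
HasSign-mono zer neg x y x≤y hx hy = contradiction
  (EventuallyPositive-mono (ℚ.neg-antimono-≤ ∘ x≤y) hy) (Null⇒¬EventuallyPositive (Null-neg hx))
HasSign-mono zer zer x y x≤y hx hy = ℕ.≤-refl
HasSign-mono zer pos x y x≤y hx hy = ℕ.n≤1+n 1
HasSign-mono pos neg x y x≤y hx hy = contradiction hy
  (¬EventuallyPositive-both (EventuallyPositive-mono x≤y hx))
HasSign-mono pos zer x y x≤y hx hy = contradiction (EventuallyPositive-mono x≤y hx)
  (Null⇒¬EventuallyPositive hy)
HasSign-mono pos pos x y x≤y hx hy = ℕ.≤-refl

HasSign-unique : ∀ s t x → HasSign s x → HasSign t x → s ≡ t
HasSign-unique s t x hs ht = rank-injective s t (ℕ.≤-antisym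
  (HasSign-mono s t x x (λ _ → ℚ.≤-refl) hs ht) (HasSign-mono t s x x (λ _ → ℚ.≤-refl) ht hs))

HasSign-resp-≈ : ∀ s x y → x ≈ℝ y → HasSign s x → HasSign s y
HasSign-resp-≈ neg x y x≈y hx = EventuallyPositive-resp-Null (-ℝ-cong {x} {y} x≈y) hx
HasSign-resp-≈ zer x y x≈y hx = Null-cong (λ n → lemma (seq x n) (seq y n)) (Null-+ hx (Null-neg x≈y))
  where
  lemma : ∀ a b → a ℚ.+ ℚ.- (a ℚ.- b) ≡ b
  lemma = solve 2 (λ a b → a :+ :- (a :- b) := b) refl
HasSign-resp-≈ pos x y x≈y hx = EventuallyPositive-resp-Null x≈y hx

HasSign-cong : ∀ s x y → seq x ≗ seq y → HasSign s x → HasSign s y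
HasSign-cong s x y x≗y = HasSign-resp-≈ s x y (≗⇒≈ℝ {x} {y} x≗y)

HasSign-* : ∀ s t x y → HasSign s x → HasSign t y → HasSign (s · t) (x *ℝ y)
HasSign-* neg neg x y hx hy = EventuallyPositive-mono
  (λ n → ℚ.≤-reflexive (neg*neg (seq x n) (seq y n))) (EventuallyPositive-* hx hy)
  where
  neg*neg : ∀ a b → ℚ.- a ℚ.* ℚ.- b ≡ a ℚ.* b
  neg*neg = solve 2 (λ a b → :- a :* :- b := a :* b) refl
HasSign-* neg zer x y hx hy = Null-* x hy
HasSign-* neg pos x y hx hy = EventuallyPositive-mono
  (λ n → ℚ.≤-reflexive (sym (ℚ.neg-distribˡ-* (seq x n) (seq y n)))) (EventuallyPositive-* hx hy)
HasSign-* zer t   x y hx hy = Null-cong (λ n → ℚ.*-comm (seq y n) (seq x n)) (Null-* y hx)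
HasSign-* pos neg x y hx hy = EventuallyPositive-mono
  (λ n → ℚ.≤-reflexive (sym (ℚ.neg-distribʳ-* (seq x n) (seq y n)))) (EventuallyPositive-* hx hy)
HasSign-* pos zer x y hx hy = Null-* x hy
HasSign-* pos pos x y hx hy = EventuallyPositive-* hx hy

-- If some term far out is at least ε/2 in absolute value, the Cauchy property keeps
-- the later ones at distance more than ε/4 from 0.
¬¬-sign : ∀ x → ¬ ¬ (∃[ s ] HasSign s x)
¬¬-sign x ¬sign = ¬sign (zer , null)
  where
  module _ (ε : ℚ) (0<ε : 0ℚ ℚ.< ε) where
    h q : ℚ
    h = ½ ℚ.* ε
    q = ½ ℚ.* h
    0<q : 0ℚ ℚ.< q
    0<q = half-positive (half-positive 0<ε)
    h-q≡q : h ℚ.- q ≡ q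
    h-q≡q = solve 1 (λ h → h :- con ½ :* h := con ½ :* h) refl h
    h+q<ε : h ℚ.+ q ℚ.< ε
    h+q<ε = subst (h ℚ.+ q ℚ.<_) (halve ε) (ℚ.+-monoʳ-< h (half< (half-positive 0<ε)))
    a+[b-a]≡b : ∀ a b → a ℚ.+ ℚ.- (a ℚ.- b) ≡ b
    a+[b-a]≡b = solve 2 (λ a b → a :+ :- (a :- b) := b) refl
    b+[a-b]≡a : ∀ a b → b ℚ.+ (a ℚ.- b) ≡ a
    b+[a-b]≡a = solve 2 (λ a b → b :+ (a :- b) := a) refl
    -b+[b-a]≡-a : ∀ a b → ℚ.- b ℚ.+ ℚ.- (a ℚ.- b) ≡ ℚ.- a
    -b+[b-a]≡-a = solve 2 (λ a b → :- b :+ :- (a :- b) := :- a) refl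

    null : ∃[ L ] (∀ n → L ℕ.≤ n → ℚ.∣ seq x n ∣ ℚ.< ε)
    null with cauchy x q 0<q
    ... | L , close with ℚ.∣ seq x L ∣ ℚ.<? h
    ...   | yes small = L , λ n p → let open ℚ.≤-Reasoning in begin-strict
            ℚ.∣ seq x n ∣                                    ≡⟨ cong ℚ.∣_∣ (b+[a-b]≡a (seq x n) (seq x L)) ⟨
            ℚ.∣ seq x L ℚ.+ (seq x n ℚ.- seq x L) ∣          ≤⟨ ℚ.∣p+q∣≤∣p∣+∣q∣ (seq x L) (seq x n ℚ.- seq x L) ⟩
            ℚ.∣ seq x L ∣ ℚ.+ ℚ.∣ seq x n ℚ.- seq x L ∣      <⟨ ℚ.+-mono-< small (close n L p ℕ.≤-refl) ⟩
            h ℚ.+ q                                          <⟨ h+q<ε ⟩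
            ε                                                ∎
    ...   | no large = contradiction (sign (ℚ.∣p∣≡p∨∣p∣≡-p (seq x L))) ¬sign
      where
      h≤ : h ℚ.≤ ℚ.∣ seq x L ∣
      h≤ = ℚ.≮⇒≥ large
      sign : ℚ.∣ seq x L ∣ ≡ seq x L ⊎ ℚ.∣ seq x L ∣ ≡ ℚ.- seq x L → ∃[ s ] HasSign s x
      sign (inj₁ eq) = pos , q , 0<q , L , λ n p → let open ℚ.≤-Reasoning in begin-strict
        q                                        ≡⟨ h-q≡q ⟨
        h ℚ.- q                                  <⟨ ℚ.+-mono-≤-< (ℚ.≤-trans h≤ (ℚ.≤-reflexive eq))
                                                      (ℚ.neg-antimono-< (ℚ.≤-<-trans (p≤∣p∣ _) (close L n ℕ.≤-refl p))) ⟩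
        seq x L ℚ.+ ℚ.- (seq x L ℚ.- seq x n)    ≡⟨ a+[b-a]≡b (seq x L) (seq x n) ⟩
        seq x n                                  ∎
      sign (inj₂ eq) = neg , q , 0<q , L , λ n p → let open ℚ.≤-Reasoning in begin-strict
        q                                        ≡⟨ h-q≡q ⟨
        h ℚ.- q                                  <⟨ ℚ.+-mono-≤-< (ℚ.≤-trans h≤ (ℚ.≤-reflexive eq))
                                                      (ℚ.neg-antimono-< (ℚ.≤-<-trans (p≤∣p∣ _) (close n L p ℕ.≤-refl))) ⟩
        ℚ.- seq x L ℚ.+ ℚ.- (seq x n ℚ.- seq x L) ≡⟨ -b+[b-a]≡-a (seq x n) (seq x L) ⟩
        ℚ.- seq x n                              ∎

IsSign : Sgn → ℂ → Set
IsSign neg = Negative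
IsSign zer = Zero
IsSign pos = Positive

p-0≡p : ∀ p → p ℚ.- 0ℚ ≡ p
p-0≡p = ℚ.+-identityʳ

IsSign⇒HasSign : ∀ s z → IsSign s z → HasSign s (re z)
IsSign⇒HasSign neg z (_ , z<0) =
  EventuallyPositive-mono (λ n → ℚ.≤-reflexive (ℚ.+-identityˡ (ℚ.- seq (re z) n))) z<0
IsSign⇒HasSign zer z (z≈0 , _) = Null-cong (p-0≡p ∘ seq (re z)) z≈0
IsSign⇒HasSign pos z (_ , 0<z) = EventuallyPositive-mono (ℚ.≤-reflexive ∘ p-0≡p ∘ seq (re z)) 0<z

HasSign⇒IsSign : ∀ s z → im z ≈ℝ 0ℝ → HasSign s (re z) → IsSign s z
HasSign⇒IsSign neg z z∈ℝ h = z∈ℝ ,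
  EventuallyPositive-mono (λ n → ℚ.≤-reflexive (sym (ℚ.+-identityˡ (ℚ.- seq (re z) n)))) h
HasSign⇒IsSign zer z z∈ℝ h = Null-cong (sym ∘ p-0≡p ∘ seq (re z)) h , z∈ℝ
HasSign⇒IsSign pos z z∈ℝ h =
  z∈ℝ , EventuallyPositive-mono (ℚ.≤-reflexive ∘ sym ∘ p-0≡p ∘ seq (re z)) h

IsSign-unique : ∀ s t z → IsSign s z → IsSign t z → s ≡ t
IsSign-unique s t z hs ht =
  HasSign-unique s t (re z) (IsSign⇒HasSign s z hs) (IsSign⇒HasSign t z ht)

-- Determinants of Hermitian matrices

-- The entries of a Hermitian matrix are conjugate only up to null sequences; after
-- hermitize the determinant formulas hold term by term.
hermitize : ∀ {n} → Matrix n → Matrix n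
hermitize M zero    zero    = re (M zero zero) +i 0ℝ
hermitize M zero    (suc j) = M zero (suc j)
hermitize M (suc i) zero    = conj (M zero (suc i))
hermitize M (suc i) (suc j) = hermitize (λ k l → M (suc k) (suc l)) i j

-- Applied to the imaginary part of a diagonal entry, which equals its own conjugate.
x≈-x⇒x≈0 : ∀ x → x ≈ℝ -ℝ x → x ≈ℝ 0ℝ
x≈-x⇒x≈0 x x≈-x = Null-cong (λ n → lemma (seq x n)) (Null-* (fromℚ ½) x≈-x)
  where
  lemma : ∀ a → ½ ℚ.* (a ℚ.- (ℚ.- a)) ≡ a ℚ.- 0ℚ
  lemma = solve 1 (λ a → con ½ :* (a :- (:- a)) := a :- con 0ℚ) refl

hermitize-≈ : ∀ {n} (M : Matrix n) → Hermitian M → ∀ i j → M i j ≈ hermitize M i j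
hermitize-≈ M h zero    zero    =
  ≈ℝ-refl {re (M zero zero)} , x≈-x⇒x≈0 (im (M zero zero)) (proj₂ (h zero zero))
hermitize-≈ M h zero    (suc j) = ≈-refl {M zero (suc j)}
hermitize-≈ M h (suc i) zero    = h (suc i) zero
hermitize-≈ M h (suc i) (suc j) = hermitize-≈ (λ k l → M (suc k) (suc l)) (λ k l → h (suc k) (suc l)) i j

hermitize-Hermitian : ∀ {n} (M : Matrix n) → Hermitian (hermitize M)
hermitize-Hermitian M zero    zero    = ≈ℝ-refl {re (M zero zero)} , ≗⇒≈ℝ {0ℝ} { -ℝ 0ℝ} (λ _ → refl)
hermitize-Hermitian M zero    (suc j) =
  ≈ℝ-refl {re (M zero (suc j))} , ≗⇒≈ℝ {im z} { -ℝ (-ℝ im z)} (λ n → lemma (seq (im z) n))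
  where
  z = M zero (suc j)
  lemma : ∀ a → a ≡ ℚ.- (ℚ.- a)
  lemma = solve 1 (λ a → a := :- (:- a)) refl
hermitize-Hermitian M (suc i) zero    = ≈-refl {conj (M zero (suc i))}
hermitize-Hermitian M (suc i) (suc j) = hermitize-Hermitian (λ k l → M (suc k) (suc l)) i j

normSq : ℂ → ℝ
normSq z = re z *ℝ re z +ℝ im z *ℝ im z

det₂ : (a b : ℝ) (x : ℂ) → ℝ
det₂ a b x = a *ℝ b -ℝ normSq x

-- The Leibniz expansion for a Hermitian matrix: the two 3-cycles contribute the conjugate products
-- x z ȳ and x̄ z̄ y, hence twice a real part, and each transposition contributes a diagonal entry
-- times a squared modulus.
det₃ : (a b c : ℝ) (x y z : ℂ) → ℝ
det₃ a b c x y z =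
  a *ℝ b *ℝ c +ℝ (t +ℝ t) -ℝ a *ℝ normSq z -ℝ b *ℝ normSq y -ℝ c *ℝ normSq x
  where t = re (x * z * conj y)

-- The operations of Defs on pairs of polynomials: evaluating these yields the terms of
-- the sequences computed in Defs.
module Symbolic {n : ℕ} where

  Poly = Polynomial n
  Polyℂ = Poly × Poly

  infixl 6 _⊕_
  infixl 7 _⊛_
  _⊕_ _⊛_ : Polyℂ → Polyℂ → Polyℂ
  (a , b) ⊕ (c , d) = a :+ c , b :+ d
  (a , b) ⊛ (c , d) = a :* c :- b :* d , a :* d :+ b :* c

  conjₚ negₚ : Polyℂ → Polyℂ
  conjₚ (a , b) = a , :- b
  negₚ (a , b) = :- a , :- b

  alternateₚ : ℕ → Polyℂ → Polyℂ
  alternateₚ zero    z = z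
  alternateₚ (suc k) z = negₚ (alternateₚ k z)

  detₚ : ∀ {k} → (Fin k → Fin k → Polyℂ) → Polyℂ
  detₚ {zero}  M = con 1ℚ , con 0ℚ
  detₚ {suc k} M = Vector.foldr _⊕_ (con 0ℚ , con 0ℚ) λ j →
    alternateₚ (toℕ j) (M zero j ⊛ detₚ (λ i l → M (suc i) (punchIn j l)))

  hermitizeₚ : ∀ {k} → (Fin k → Fin k → Polyℂ) → Fin k → Fin k → Polyℂ
  hermitizeₚ M zero    zero    = proj₁ (M zero zero) , con 0ℚ
  hermitizeₚ M zero    (suc j) = M zero (suc j)
  hermitizeₚ M (suc i) zero    = conjₚ (M zero (suc i))
  hermitizeₚ M (suc i) (suc j) = hermitizeₚ (λ k l → M (suc k) (suc l)) i j

  normSqₚ : Polyℂ → Poly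
  normSqₚ (a , b) = a :* a :+ b :* b

  det₂ₚ : (a b : Poly) (x : Polyℂ) → Poly
  det₂ₚ a b x = a :* b :- normSqₚ x

  det₃ₚ : (a b c : Poly) (x y z : Polyℂ) → Poly
  det₃ₚ a b c x y z = a :* b :* c :+ (t :+ t) :- a :* normSqₚ z :- b :* normSqₚ y :- c :* normSqₚ x
    where t = proj₁ (x ⊛ z ⊛ conjₚ y)

  -- `hermitizeₚ` overwrites everything below the diagonal, so the values placed there, here and in
  -- `upper₃ₚ`, are fillers.
  upper₂ₚ : (a b : Poly) (x : Polyℂ) → Fin 2 → Fin 2 → Polyℂ
  upper₂ₚ a b x zero    zero    = a , con 0ℚ
  upper₂ₚ a b x zero    (suc _) = x
  upper₂ₚ a b x (suc _) _       = b , con 0ℚ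

  upper₃ₚ : (a b c : Poly) (x y z : Polyℂ) → Fin 3 → Fin 3 → Polyℂ
  upper₃ₚ a b c x y z zero    zero          = a , con 0ℚ
  upper₃ₚ a b c x y z zero    (suc zero)    = x
  upper₃ₚ a b c x y z zero    (suc (suc _)) = y
  upper₃ₚ a b c x y z (suc i) zero          = x
  upper₃ₚ a b c x y z (suc i) (suc j)       = upper₂ₚ b c z i j

open Symbolic

det-hermitize₁ : ∀ (M : Matrix 1) n →
  seq (re (det (hermitize M))) n ≡ seq (re (M zero zero)) n ×
  seq (im (det (hermitize M))) n ≡ 0ℚ
det-hermitize₁ M n =
    solve 1 (λ a → proj₁ (detₚ (λ (_ _ : Fin 1) → a , con 0ℚ)) := a) refl (seq (re (M zero zero)) n)
  , solve 1 (λ a → proj₂ (detₚ (λ (_ _ : Fin 1) → a , con 0ℚ)) := con 0ℚ) refl (seq (re (M zero zero)) n)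

det-hermitize₂ : ∀ (M : Matrix 2) n → let i = zero; j = suc zero in
  seq (re (det (hermitize M))) n ≡ seq (det₂ (re (M i i)) (re (M j j)) (M i j)) n ×
  seq (im (det (hermitize M))) n ≡ 0ℚ
det-hermitize₂ M n =
    solve 4 (λ a b x₁ x₂ → proj₁ (detₚ (hermitizeₚ (upper₂ₚ a b (x₁ , x₂)))) := det₂ₚ a b (x₁ , x₂)) refl
      (seq (re (M i i)) n) (seq (re (M j j)) n) (seq (re (M i j)) n) (seq (im (M i j)) n)
  , solve 4 (λ a b x₁ x₂ → proj₂ (detₚ (hermitizeₚ (upper₂ₚ a b (x₁ , x₂)))) := con 0ℚ) refl
      (seq (re (M i i)) n) (seq (re (M j j)) n) (seq (re (M i j)) n) (seq (im (M i j)) n)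
  where
  i = zero
  j = suc zero

det-hermitize₃ : ∀ (M : Matrix 3) n → let i = zero; j = suc zero; k = suc (suc zero) in
  seq (re (det (hermitize M))) n ≡
    seq (det₃ (re (M i i)) (re (M j j)) (re (M k k)) (M i j) (M i k) (M j k)) n ×
  seq (im (det (hermitize M))) n ≡ 0ℚ
det-hermitize₃ M n =
    solve 9 (λ a b c x₁ x₂ y₁ y₂ z₁ z₂ →
      let x = x₁ , x₂; y = y₁ , y₂; z = z₁ , z₂ in
      proj₁ (detₚ (hermitizeₚ (upper₃ₚ a b c x y z))) := det₃ₚ a b c x y z) refl
      (seq (re (M i i)) n) (seq (re (M j j)) n) (seq (re (M k k)) n)
      (seq (re (M i j)) n) (seq (im (M i j)) n) (seq (re (M i k)) n)
      (seq (im (M i k)) n) (seq (re (M j k)) n) (seq (im (M j k)) n)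
  , solve 9 (λ a b c x₁ x₂ y₁ y₂ z₁ z₂ →
      let x = x₁ , x₂; y = y₁ , y₂; z = z₁ , z₂ in
      proj₂ (detₚ (hermitizeₚ (upper₃ₚ a b c x y z))) := con 0ℚ) refl
      (seq (re (M i i)) n) (seq (re (M j j)) n) (seq (re (M k k)) n)
      (seq (re (M i j)) n) (seq (im (M i j)) n) (seq (re (M i k)) n)
      (seq (im (M i k)) n) (seq (re (M j k)) n) (seq (im (M j k)) n)
  where
  i = zero
  j = suc zero
  k = suc (suc zero)

det-hermitize : ∀ {n} (M : Matrix n) → Hermitian M → det M ≈ det (hermitize M)
det-hermitize M h = det-cong M (hermitize M) (hermitize-≈ M h)

-- Read off from the explicit expansions, whence the bound on the size.
det-real : ∀ {n} → n ℕ.≤ 3 → (M : Matrix n) → Hermitian M → im (det M) ≈ℝ 0ℝ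
det-real {n} n≤3 M h = ≈ℝ-trans {im (det M)} {im (det (hermitize M))} {0ℝ}
  (proj₂ (det-hermitize M h)) (≗⇒≈ℝ {im (det (hermitize M))} {0ℝ} (lemma n n≤3 M))
  where
  lemma : ∀ n → n ℕ.≤ 3 → (M : Matrix n) → ∀ m → seq (im (det (hermitize M))) m ≡ 0ℚ
  lemma 0 _ M m = refl
  lemma 1 _ M m = proj₂ (det-hermitize₁ M m)
  lemma 2 _ M m = proj₂ (det-hermitize₂ M m)
  lemma 3 _ M m = proj₂ (det-hermitize₃ M m)
  lemma (suc (suc (suc (suc _)))) (ℕ.s≤s (ℕ.s≤s (ℕ.s≤s ()))) M m

-- Sign constraints

det₂-swap : ∀ a b x → seq (det₂ a b x) ≗ seq (det₂ b a (conj x))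
det₂-swap a b x n =
  solve 4 (λ a b x₁ x₂ → let x = x₁ , x₂ in det₂ₚ a b x := det₂ₚ b a (conjₚ x)) refl
    (seq a n) (seq b n) (seq (re x) n) (seq (im x) n)

-- Relabelling the indices by 1 → 2 → 3 → 1 puts the entries at 23, 21, 31 in place of those at 12,
-- 13, 23. It lets one proof of the constraints serve all three diagonal entries.
det₃-cycle : ∀ a b c x y z → seq (det₃ a b c x y z) ≗ seq (det₃ b c a z (conj x) (conj y))
det₃-cycle a b c x y z n =
  solve 9 (λ a b c x₁ x₂ y₁ y₂ z₁ z₂ → let x = x₁ , x₂; y = y₁ , y₂; z = z₁ , z₂ in
    det₃ₚ a b c x y z := det₃ₚ b c a z (conjₚ x) (conjₚ y)) refl
    (seq a n) (seq b n) (seq c n) (seq (re x) n) (seq (im x) n)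
    (seq (re y) n) (seq (im y) n) (seq (re z) n) (seq (im z) n)

-- The common form of ab - |x|² ≤ ab and of the Schur inequality: a squared modulus is subtracted.
p-[q²+r²]≤p : ∀ p q r → p ℚ.- (q ℚ.* q ℚ.+ r ℚ.* r) ℚ.≤ p
p-[q²+r²]≤p p q r = let open ℚ.≤-Reasoning in begin
  p ℚ.- (q ℚ.* q ℚ.+ r ℚ.* r)    ≤⟨ ℚ.+-monoʳ-≤ p (ℚ.neg-antimono-≤ (ℚ.+-mono-≤ (0≤p*p q) (0≤p*p r))) ⟩
  p ℚ.- (0ℚ ℚ.+ 0ℚ)              ≡⟨ solve 1 (λ p → p :- (con 0ℚ :+ con 0ℚ) := p) refl p ⟩
  p                              ∎

det₂≤product : ∀ a b x n → seq (det₂ a b x) n ℚ.≤ seq (a *ℝ b) n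
det₂≤product a b x n = p-[q²+r²]≤p (seq (a *ℝ b) n) (seq (re x) n) (seq (im x) n)

module _ (a b c : ℝ) (x y z : ℂ) where

  -- a det = (ab − |x|²)(ac − |y|²) − |az − x̄y|², the Schur complement of a.
  schur : ∀ n → seq (a *ℝ det₃ a b c x y z) n ℚ.≤ seq (det₂ a b x *ℝ det₂ a c y) n
  schur n = subst (ℚ._≤ seq (det₂ a b x *ℝ det₂ a c y) n)
    (sym (solve 9 (λ a b c x₁ x₂ y₁ y₂ z₁ z₂ →
        let x = x₁ , x₂; y = y₁ , y₂; z = z₁ , z₂
            w = (a :* z₁ , a :* z₂) ⊕ negₚ (conjₚ x ⊛ y) in
        a :* det₃ₚ a b c x y z := det₂ₚ a b x :* det₂ₚ a c y :- normSqₚ w) refl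
      (seq a n) (seq b n) (seq c n) (seq (re x) n) (seq (im x) n)
      (seq (re y) n) (seq (im y) n) (seq (re z) n) (seq (im z) n)))
    (p-[q²+r²]≤p (seq (det₂ a b x *ℝ det₂ a c y) n) (seq (re w) n) (seq (im w) n))
    where w = ((a *ℝ re z) +i (a *ℝ im z)) + (- (conj x * y))

  -- If a and ab − |x|² vanish then so does x.
  degenerate : Null (seq a) → Null (seq (det₂ a b x)) → det₃ a b c x y z ≈ℝ b *ℝ det₂ a c y
  degenerate a→0 ab-xx̄→0 = Null-cong (λ n → solve 9 (λ a b c x₁ x₂ y₁ y₂ z₁ z₂ →
        let x = x₁ , x₂; y = y₁ , y₂; z = z₁ , z₂; t = z ⊛ conjₚ y in
        -- The difference is 2 Re (x t) - c|x|² - a|z|² with t = z ȳ, grouped so that every summand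
        -- contains one of the null factors x₁, x₂, a.
        (proj₁ t :+ proj₁ t :- c :* x₁) :* x₁ :+ (:- (proj₂ t :+ proj₂ t) :- c :* x₂) :* x₂
          :+ (:- normSqₚ z) :* a
          := det₃ₚ a b c x y z :- b :* det₂ₚ a c y) refl
      (seq a n) (seq b n) (seq c n) (seq (re x) n) (seq (im x) n)
      (seq (re y) n) (seq (im y) n) (seq (re z) n) (seq (im z) n))
    (Null-+ (Null-+ (Null-* (re t +ℝ re t -ℝ c *ℝ re x) x₁→0) (Null-* (-ℝ (im t +ℝ im t) -ℝ c *ℝ im x) x₂→0))
      (Null-* (-ℝ normSq z) a→0))
    where
    t = z * conj y
    xx̄→0 : Null (seq (normSq x))
    xx̄→0 = Null-cong (λ n → solve 3 (λ a b p → b :* a :+ :- (a :* b :- p) := p) refl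
        (seq a n) (seq b n) (seq (normSq x) n))
      (Null-+ (Null-* b a→0) (Null-neg ab-xx̄→0))
    x₁→0 : Null (seq (re x))
    x₁→0 = Null-sqrt (λ n → ℚ.≤-trans (ℚ.≤-reflexive (sym (ℚ.+-identityʳ _)))
      (ℚ.+-monoʳ-≤ (seq (re x *ℝ re x) n) (0≤p*p (seq (im x) n)))) xx̄→0
    x₂→0 : Null (seq (im x))
    x₂→0 = Null-sqrt (λ n → ℚ.≤-trans (ℚ.≤-reflexive (sym (ℚ.+-identityˡ _)))
      (ℚ.+-monoˡ-≤ (seq (im x *ℝ im x) n) (0≤p*p (seq (re x) n)))) xx̄→0

-- The constraints among the signs of a, b, ab − |x|², ac − |y|² and the determinant.
Constraint : (a b p q d : Sgn) → Set
Constraint a b p q d = p ⊑ a · b × a · d ⊑ p · q × (a ≡ zer → p ≡ zer → d ≡ b · q)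

constraint : ∀ a b c x y z {sa sb sp sq sd} →
  HasSign sa a → HasSign sb b → HasSign sp (det₂ a b x) → HasSign sq (det₂ a c y) →
  HasSign sd (det₃ a b c x y z) → Constraint sa sb sp sq sd
constraint a b c x y z {sa} {sb} {sp} {sq} {sd} ha hb hp hq hd =
    HasSign-mono sp (sa · sb) (det₂ a b x) (a *ℝ b) (det₂≤product a b x) hp (HasSign-* sa sb a b ha hb)
  , HasSign-mono (sa · sd) (sp · sq) (a *ℝ det₃ a b c x y z) (det₂ a b x *ℝ det₂ a c y) (schur a b c x y z)
      (HasSign-* sa sd a (det₃ a b c x y z) ha hd) (HasSign-* sp sq (det₂ a b x) (det₂ a c y) hp hq)
  , λ { refl refl → HasSign-unique sd (sb · sq) (b *ℝ det₂ a c y)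
      (HasSign-resp-≈ sd (det₃ a b c x y z) (b *ℝ det₂ a c y) (degenerate a b c x y z ha hp) hd)
      (HasSign-* sb sq b (det₂ a c y) hb hq) }

-- The signs `p`, `q`, `r` belong to the index pairs 12, 13, 23, which explains their order in the
-- rotated constraints.
Admissible : (a b c p q r d : Sgn) → Set
Admissible a b c p q r d = Constraint a b p q d × Constraint b c r p d × Constraint c a q r d

admissible : ∀ a b c x y z {sa sb sc sp sq sr sd} →
  HasSign sa a → HasSign sb b → HasSign sc c →
  HasSign sp (det₂ a b x) → HasSign sq (det₂ a c y) → HasSign sr (det₂ b c z) →
  HasSign sd (det₃ a b c x y z) → Admissible sa sb sc sp sq sr sd
admissible a b c x y z {sp = sp} {sq} {sr} {sd} ha hb hc hp hq hr hd =
    constraint a b c x y z ha hb hp hq hd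
  , constraint b c a z (conj x) (conj y) hb hc hr hp′ hd′
  -- Two rotations bring x back only as a double conjugate.
  , constraint c a b (conj y) (conj z) (conj (conj x)) hc ha hq′ hr′ hd″
  where
  hp′ = HasSign-cong sp (det₂ a b x) (det₂ b a (conj x)) (det₂-swap a b x) hp
  hq′ = HasSign-cong sq (det₂ a c y) (det₂ c a (conj y)) (det₂-swap a c y) hq
  hr′ = HasSign-cong sr (det₂ b c z) (det₂ c b (conj z)) (det₂-swap b c z) hr
  hd′ = HasSign-cong sd (det₃ a b c x y z) (det₃ b c a z (conj x) (conj y)) (det₃-cycle a b c x y z) hd
  hd″ = HasSign-cong sd (det₃ b c a z (conj x) (conj y)) (det₃ c a b (conj y) (conj z) (conj (conj x)))
    (det₃-cycle b c a z (conj x) (conj y)) hd′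

infix 4 _≟ˢ_
_≟ˢ_ : DecidableEquality Sgn
s ≟ˢ t = map′ (rank-injective s t) (cong rank) (rank s ℕ.≟ rank t)

-- Symbols

-- The seven symbols correspond to the seven nonempty subsets of the three signs, namely the signs
-- that occur among the minors of the given order. This is the characteristic function of that
-- subset.
presence : SignSymbol → Sgn → Bool
presence A* neg = true
presence A* zer = false
presence A* pos = true
presence A⁺ neg = false
presence A⁺ zer = false
presence A⁺ pos = true
presence A⁻ neg = true
presence A⁻ zer = false
presence A⁻ pos = false
presence N  neg = false
presence N  zer = true
presence N  pos = false
presence S* neg = true
presence S* zer = true
presence S* pos = true
presence S⁺ neg = false
presence S⁺ zer = true
presence S⁺ pos = true
presence S⁻ neg = true
presence S⁻ zer = true
presence S⁻ pos = false

-- The first equation is a junk value.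
symbol : (neg? zer? pos? : Bool) → SignSymbol
symbol false false false = N
symbol false false true  = A⁺
symbol false true  false = N
symbol false true  true  = S⁺
symbol true  false false = A⁻
symbol true  false true  = A*
symbol true  true  false = S⁻
symbol true  true  true  = S*

symbol-presence : ∀ t → symbol (presence t neg) (presence t zer) (presence t pos) ≡ t
symbol-presence A* = refl
symbol-presence A⁺ = refl
symbol-presence A⁻ = refl
symbol-presence N  = refl
symbol-presence S* = refl
symbol-presence S⁺ = refl
symbol-presence S⁻ = refl

_≟_ : DecidableEquality SignSymbol
t ≟ u = map′ injective (cong code)
  (Product.≡-dec Bool._≟_ (Product.≡-dec Bool._≟_ Bool._≟_) (code t) (code u))
  where
  code : SignSymbol → Bool × Bool × Bool
  code t = presence t neg , presence t zer , presence t pos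
  decode : Bool × Bool × Bool → SignSymbol
  decode (b , c , d) = symbol b c d
  injective : code t ≡ code u → t ≡ u
  injective eq = trans (sym (symbol-presence t)) (trans (cong decode eq) (symbol-presence u))

module _ {n : ℕ} (σ : Subset n → Sgn) (k : ℕ) where

  Occurs : Sgn → Set
  Occurs s = ∃[ α ] ∣ α ∣ ≡ k × σ α ≡ s

  occurs? : Decidable Occurs
  occurs? s = anySubset? λ α → (∣ α ∣ ℕ.≟ k) ×-dec (σ α ≟ˢ s)

  symbolAt : SignSymbol
  symbolAt = symbol (does (occurs? neg)) (does (occurs? zer)) (does (occurs? pos))

  -- The clauses of `HasSymbol` mix universal and existential conditions. Each is recast as three
  -- yes-or-no facts, which together determine the symbol.
  Pattern : SignSymbol → Set
  Pattern t = ∀ s → Reflects (Occurs s) (presence t s)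

  Pattern⇒symbolAt : ∀ t → Pattern t → t ≡ symbolAt
  Pattern⇒symbolAt t reflects
    rewrite Reflects.det (proof (occurs? neg)) (reflects neg)
          | Reflects.det (proof (occurs? zer)) (reflects zer)
          | Reflects.det (proof (occurs? pos)) (reflects pos) = sym (symbol-presence t)

  symbolAt-Pattern : ∃[ α ] ∣ α ∣ ≡ k → Pattern symbolAt
  symbolAt-Pattern (α , ∣α∣≡k) = reflects (occurs? neg) (occurs? zer) (occurs? pos)
    where
    reflects : (n? : Dec (Occurs neg)) (z? : Dec (Occurs zer)) (p? : Dec (Occurs pos)) →
      Pattern (symbol (does n?) (does z?) (does p?))
    -- The sign of the given minor does occur, so the junk value is never reached.
    reflects (no ¬n) (no ¬z) (no ¬p) s with σ α in eq
    ... | neg = contradiction (α , ∣α∣≡k , eq) ¬n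
    ... | zer = contradiction (α , ∣α∣≡k , eq) ¬z
    ... | pos = contradiction (α , ∣α∣≡k , eq) ¬p
    reflects (no ¬n) (no ¬z) (yes p) = λ { neg → ofⁿ ¬n ; zer → ofⁿ ¬z ; pos → ofʸ p }
    reflects (no ¬n) (yes z) (no ¬p) = λ { neg → ofⁿ ¬n ; zer → ofʸ z ; pos → ofⁿ ¬p }
    reflects (no ¬n) (yes z) (yes p) = λ { neg → ofⁿ ¬n ; zer → ofʸ z ; pos → ofʸ p }
    reflects (yes n) (no ¬z) (no ¬p) = λ { neg → ofʸ n ; zer → ofⁿ ¬z ; pos → ofⁿ ¬p }
    reflects (yes n) (no ¬z) (yes p) = λ { neg → ofʸ n ; zer → ofⁿ ¬z ; pos → ofʸ p }
    reflects (yes n) (yes z) (no ¬p) = λ { neg → ofʸ n ; zer → ofʸ z ; pos → ofⁿ ¬p }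
    reflects (yes n) (yes z) (yes p) = λ { neg → ofʸ n ; zer → ofʸ z ; pos → ofʸ p }

  module _ (B : Matrix n) (signs : ∀ α → IsSign (σ α) (principalMinor B α))
           (inhabited : ∃[ α ] ∣_∣ {n} α ≡ k) where
    private
      some⇒occurs : ∀ s → SomeMinor B k (IsSign s) → Occurs s
      some⇒occurs s (α , eq , h) = α , eq , IsSign-unique (σ α) s (principalMinor B α) (signs α) h

      occurs⇒some : ∀ s → Occurs s → SomeMinor B k (IsSign s)
      occurs⇒some s (α , eq , refl) = α , eq , signs α

      -- If no subset had `k` elements, `A⁺`, `A⁻` and `N` would all hold vacuously; `inhabited`
      -- excludes this.
      all⇒occurs : ∀ s → AllMinors B k (IsSign s) → Occurs s
      all⇒occurs s h = let α , eq = inhabited in some⇒occurs s (α , eq , h α eq)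

      all⇒¬occurs : ∀ s {t} → s ≢ t → AllMinors B k (IsSign s) → ¬ Occurs t
      all⇒¬occurs s s≢t h (α , eq , refl) =
        s≢t (IsSign-unique s (σ α) (principalMinor B α) (h α eq) (signs α))

      ¬occurs⇒all : ∀ s → (∀ t → t ≢ s → ¬ Occurs t) → AllMinors B k (IsSign s)
      ¬occurs⇒all s h α eq with σ α ≟ˢ s
      ... | yes refl = signs α
      ... | no σα≢s  = contradiction (α , eq , refl) (h (σ α) σα≢s)

      nonZero : ∀ α → σ α ≢ zer → NonZero (principalMinor B α)
      nonZero α σα≢0 z≈0 = σα≢0 (IsSign-unique (σ α) zer (principalMinor B α) (signs α) z≈0)

      nonZero⇒sign≢zer : ∀ α → NonZero (principalMinor B α) → σ α ≢ zer
      nonZero⇒sign≢zer α z≉0 eq = z≉0 (subst (λ s → IsSign s (principalMinor B α)) eq (signs α))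

      module _ (s : Sgn) (h : AllMinors B k (λ z → NonZero z → IsSign s z)) where

        semi⇒occurs : SomeMinor B k NonZero → Occurs s
        semi⇒occurs (α , eq , z≉0) = some⇒occurs s (α , eq , h α eq z≉0)

        semi⇒¬occurs : ∀ {t} → t ≢ zer → s ≢ t → ¬ Occurs t
        semi⇒¬occurs t≢0 s≢t (α , eq , refl) = s≢t
          (IsSign-unique s (σ α) (principalMinor B α) (h α eq (nonZero α t≢0)) (signs α))

      ¬occurs⇒semi : ∀ s → (∀ t → t ≢ zer → t ≢ s → ¬ Occurs t) →
        AllMinors B k (λ z → NonZero z → IsSign s z)
      ¬occurs⇒semi s h α eq z≉0 with σ α ≟ˢ s
      ... | yes refl = signs α
      ... | no σα≢s  = contradiction (α , eq , refl) (h (σ α) (nonZero⇒sign≢zer α z≉0) σα≢s)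

      occurs⇒nonZero : ∀ s → s ≢ zer → Occurs s → SomeMinor B k NonZero
      occurs⇒nonZero s s≢0 (α , eq , refl) = α , eq , nonZero α s≢0

    HasSymbol⇒Pattern : ∀ t → HasSymbol B k t → Pattern t
    HasSymbol⇒Pattern A* (_ , _ , n) neg = ofʸ (some⇒occurs neg n)
    HasSymbol⇒Pattern A* (h , _ , _) zer =
      ofⁿ λ (α , eq , σα≡0) → nonZero⇒sign≢zer α (h α eq) σα≡0
    HasSymbol⇒Pattern A* (_ , p , _) pos = ofʸ (some⇒occurs pos p)
    HasSymbol⇒Pattern A⁺ h neg = ofⁿ (all⇒¬occurs pos (λ ()) h)
    HasSymbol⇒Pattern A⁺ h zer = ofⁿ (all⇒¬occurs pos (λ ()) h)
    HasSymbol⇒Pattern A⁺ h pos = ofʸ (all⇒occurs pos h)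
    HasSymbol⇒Pattern A⁻ h neg = ofʸ (all⇒occurs neg h)
    HasSymbol⇒Pattern A⁻ h zer = ofⁿ (all⇒¬occurs neg (λ ()) h)
    HasSymbol⇒Pattern A⁻ h pos = ofⁿ (all⇒¬occurs neg (λ ()) h)
    HasSymbol⇒Pattern N  h neg = ofⁿ (all⇒¬occurs zer (λ ()) h)
    HasSymbol⇒Pattern N  h zer = ofʸ (all⇒occurs zer h)
    HasSymbol⇒Pattern N  h pos = ofⁿ (all⇒¬occurs zer (λ ()) h)
    HasSymbol⇒Pattern S* (_ , n , _) neg = ofʸ (some⇒occurs neg n)
    HasSymbol⇒Pattern S* (_ , _ , z) zer = ofʸ (some⇒occurs zer z)
    HasSymbol⇒Pattern S* (p , _ , _) pos = ofʸ (some⇒occurs pos p)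
    HasSymbol⇒Pattern S⁺ (_ , _ , h) neg = ofⁿ (semi⇒¬occurs pos h (λ ()) (λ ()))
    HasSymbol⇒Pattern S⁺ (z , _ , _) zer = ofʸ (some⇒occurs zer z)
    HasSymbol⇒Pattern S⁺ (_ , x , h) pos = ofʸ (semi⇒occurs pos h x)
    HasSymbol⇒Pattern S⁻ (_ , x , h) neg = ofʸ (semi⇒occurs neg h x)
    HasSymbol⇒Pattern S⁻ (z , _ , _) zer = ofʸ (some⇒occurs zer z)
    HasSymbol⇒Pattern S⁻ (_ , _ , h) pos = ofⁿ (semi⇒¬occurs neg h (λ ()) (λ ()))

    Pattern⇒HasSymbol : ∀ t → Pattern t → HasSymbol B k t
    Pattern⇒HasSymbol A* h =
        (λ α eq → nonZero α λ σα≡0 → Reflects.invert (h zer) (α , eq , σα≡0))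
      , occurs⇒some pos (Reflects.invert (h pos)) , occurs⇒some neg (Reflects.invert (h neg))
    Pattern⇒HasSymbol A⁺ h = ¬occurs⇒all pos λ
      { neg _ → Reflects.invert (h neg) ; zer _ → Reflects.invert (h zer) ; pos ≢ → contradiction refl ≢ }
    Pattern⇒HasSymbol A⁻ h = ¬occurs⇒all neg λ
      { pos _ → Reflects.invert (h pos) ; zer _ → Reflects.invert (h zer) ; neg ≢ → contradiction refl ≢ }
    Pattern⇒HasSymbol N  h = ¬occurs⇒all zer λ
      { neg _ → Reflects.invert (h neg) ; pos _ → Reflects.invert (h pos) ; zer ≢ → contradiction refl ≢ }
    Pattern⇒HasSymbol S* h = occurs⇒some pos (Reflects.invert (h pos))
      , occurs⇒some neg (Reflects.invert (h neg)) , occurs⇒some zer (Reflects.invert (h zer))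
    Pattern⇒HasSymbol S⁺ h = occurs⇒some zer (Reflects.invert (h zer))
      , occurs⇒nonZero pos (λ ()) (Reflects.invert (h pos))
      , ¬occurs⇒semi pos λ { neg _ _ → Reflects.invert (h neg)
                           ; zer ≢ _ → contradiction refl ≢ ; pos _ ≢ → contradiction refl ≢ }
    Pattern⇒HasSymbol S⁻ h = occurs⇒some zer (Reflects.invert (h zer))
      , occurs⇒nonZero neg (λ ()) (Reflects.invert (h neg))
      , ¬occurs⇒semi neg λ { pos _ _ → Reflects.invert (h pos)
                           ; zer ≢ _ → contradiction refl ≢ ; neg _ ≢ → contradiction refl ≢ }

-- Sepr-sequences computed from given signs

subset-of-size : ∀ {n} (i : Fin n) → ∃[ α ] ∣_∣ {n} α ≡ suc (toℕ i)
subset-of-size {suc n} zero    = true ∷ ⊥ , cong suc (∣⊥∣≡0 n)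
subset-of-size         (suc i) with subset-of-size i
... | α , eq = true ∷ α , cong suc eq

-- The relation `_HasSepr_` becomes this function once the sign of every principal minor is
-- supplied.
sepr : ∀ {n} → (Subset n → Sgn) → SignSequence n
sepr σ = tabulate λ i → symbolAt σ (suc (toℕ i))

module _ {n : ℕ} (B : Matrix n) (σ : Subset n → Sgn)
         (signs : ∀ α → IsSign (σ α) (principalMinor B α)) where

  HasSepr-unique : ∀ t → B HasSepr t → t ≡ sepr σ
  HasSepr-unique t h = trans (sym (tabulate∘lookup t)) (tabulate-cong λ i →
    Pattern⇒symbolAt σ _ (lookup t i)
      (HasSymbol⇒Pattern σ _ B signs (subset-of-size i) (lookup t i) (h i)))

  HasSepr-sepr : B HasSepr sepr σ
  HasSepr-sepr i = subst (HasSymbol B (suc (toℕ i))) (sym (lookup∘tabulate _ i))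
    (Pattern⇒HasSymbol σ _ B signs (subset-of-size i) (symbolAt σ (suc (toℕ i)))
      (symbolAt-Pattern σ _ (subset-of-size i)))

minor-real : ∀ {n} → n ℕ.≤ 3 → (B : Matrix n) → Hermitian B → ∀ α → im (principalMinor B α) ≈ℝ 0ℝ
minor-real n≤3 B h α = det-real (ℕ.≤-trans (∣p∣≤n α) n≤3)
  (λ i j → B (element α i) (element α j)) (λ i j → h (element α i) (element α j))

-- Necessity of the list

_∈?_ : ∀ {n k} (t : SignSequence n) (ts : Vec (SignSequence n) k) → Dec (t ∈ ts)
t ∈? ts = DecMembership._∈?_ (≡-dec _≟_) t ts

∀Sgn? : ∀ {P : Sgn → Set} → Decidable P → Dec (∀ s → P s)
∀Sgn? P? = map′ (λ (n , z , p) → λ { neg → n ; zer → z ; pos → p }) (λ h → h neg , h zer , h pos)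
  (P? neg ×-dec P? zer ×-dec P? pos)

_⊑?_ : ∀ s t → Dec (s ⊑ t)
s ⊑? t = rank s ℕ.≤? rank t

constraint? : ∀ a b p q d → Dec (Constraint a b p q d)
constraint? a b p q d = (p ⊑? (a · b)) ×-dec ((a · d) ⊑? (p · q)) ×-dec
  ((a ≟ˢ zer) →-dec (p ≟ˢ zer) →-dec (d ≟ˢ (b · q)))

admissible? : ∀ a b c p q r d → Dec (Admissible a b c p q r d)
admissible? a b c p q r d = constraint? a b p q d ×-dec constraint? b c r p d ×-dec constraint? c a q r d

-- The empty minor is `1ℂ`, so the empty subset gets `pos`, here and in the two definitions that
-- follow.
signs₁ : (a : Sgn) → Subset 1 → Sgn
signs₁ a (false ∷ []) = pos
signs₁ a (true  ∷ []) = a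

signs₂ : (a b p : Sgn) → Subset 2 → Sgn
signs₂ a b p (false ∷ false ∷ []) = pos
signs₂ a b p (true  ∷ false ∷ []) = a
signs₂ a b p (false ∷ true  ∷ []) = b
signs₂ a b p (true  ∷ true  ∷ []) = p

signs₃ : (a b c p q r d : Sgn) → Subset 3 → Sgn
signs₃ a b c p q r d (false ∷ false ∷ false ∷ []) = pos
signs₃ a b c p q r d (true  ∷ false ∷ false ∷ []) = a
signs₃ a b c p q r d (false ∷ true  ∷ false ∷ []) = b
signs₃ a b c p q r d (false ∷ false ∷ true  ∷ []) = c
signs₃ a b c p q r d (true  ∷ true  ∷ false ∷ []) = p
signs₃ a b c p q r d (true  ∷ false ∷ true  ∷ []) = q
signs₃ a b c p q r d (false ∷ true  ∷ true  ∷ []) = r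
signs₃ a b c p q r d (true  ∷ true  ∷ true  ∷ []) = d

sepr-signs₁ : ∀ a → sepr (signs₁ a) ∈ sequences₁
sepr-signs₁ = from-yes (∀Sgn? λ a → sepr (signs₁ a) ∈? sequences₁)

sepr-signs₂ : ∀ a b p → p ⊑ a · b → sepr (signs₂ a b p) ∈ sequences₂
sepr-signs₂ = from-yes (∀Sgn? λ a → ∀Sgn? λ b → ∀Sgn? λ p →
  (p ⊑? (a · b)) →-dec (sepr (signs₂ a b p) ∈? sequences₂))

-- A finite check by evaluation, over the 3⁷ = 2187 tuples of signs.
sepr-signs₃ : ∀ a b c p q r d → Admissible a b c p q r d → sepr (signs₃ a b c p q r d) ∈ sequences₃
sepr-signs₃ = from-yes (∀Sgn? λ a → ∀Sgn? λ b → ∀Sgn? λ c → ∀Sgn? λ p → ∀Sgn? λ q → ∀Sgn? λ r → ∀Sgn? λ d →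
  admissible? a b c p q r d →-dec (sepr (signs₃ a b c p q r d) ∈? sequences₃))

principal : ∀ {n} → Matrix n → (α : Subset n) → Matrix ∣ α ∣
principal B α i j = B (element α i) (element α j)

¬¬-minor-sign : ∀ {n} → n ℕ.≤ 3 → (B : Matrix n) → Hermitian B →
  ∀ α → ¬ ¬ (∃[ s ] IsSign s (principalMinor B α))
¬¬-minor-sign n≤3 B h α ¬sign = ¬¬-sign (re (principalMinor B α)) λ (s , hs) →
  ¬sign (s , HasSign⇒IsSign s (principalMinor B α) (minor-real n≤3 B h α) hs)

module _ (s : Sgn) where

  -- Signs survive null perturbations, so `M` may be replaced by `hermitize M`, whose determinant is
  -- the explicit formula at every index.
  det₁-sign : (M : Matrix 1) → Hermitian M → IsSign s (det M) → HasSign s (re (M zero zero))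
  det₁-sign M h hs =
    HasSign-cong s (re (det (hermitize M))) (re (M zero zero)) (proj₁ ∘ det-hermitize₁ M)
      (HasSign-resp-≈ s (re (det M)) (re (det (hermitize M))) (proj₁ (det-hermitize M h))
        (IsSign⇒HasSign s (det M) hs))

  det₂-sign : (M : Matrix 2) → Hermitian M → IsSign s (det M) → let i = zero; j = suc zero in
    HasSign s (det₂ (re (M i i)) (re (M j j)) (M i j))
  det₂-sign M h hs =
    HasSign-cong s (re (det (hermitize M))) (det₂ (re (M i i)) (re (M j j)) (M i j))
      (proj₁ ∘ det-hermitize₂ M)
      (HasSign-resp-≈ s (re (det M)) (re (det (hermitize M))) (proj₁ (det-hermitize M h))
        (IsSign⇒HasSign s (det M) hs))
    where
    i = zero
    j = suc zero

  det₃-sign : (M : Matrix 3) → Hermitian M → IsSign s (det M) →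
    let i = zero; j = suc zero; k = suc (suc zero) in
    HasSign s (det₃ (re (M i i)) (re (M j j)) (re (M k k)) (M i j) (M i k) (M j k))
  det₃-sign M h hs =
    HasSign-cong s (re (det (hermitize M)))
      (det₃ (re (M i i)) (re (M j j)) (re (M k k)) (M i j) (M i k) (M j k))
      (proj₁ ∘ det-hermitize₃ M)
      (HasSign-resp-≈ s (re (det M)) (re (det (hermitize M))) (proj₁ (det-hermitize M h))
        (IsSign⇒HasSign s (det M) hs))
    where
    i = zero
    j = suc zero
    k = suc (suc zero)

1ℂ-positive : Positive 1ℂ
1ℂ-positive = ≈ℝ-refl {0ℝ} , ½ , ℚ.positive⁻¹ ½ , 0 , λ _ _ → from-yes (½ ℚ.<? 1ℚ ℚ.- 0ℚ)

Attained⇒∈₁ : ∀ t → Attained t → t ∈ sequences₁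
Attained⇒∈₁ t (B , h , B-sepr) = decidable-stable (t ∈? sequences₁) λ t∉ →
  minor-sign (true ∷ []) λ (a , ha) →
  t∉ (subst (_∈ sequences₁)
    (sym (HasSepr-unique B (signs₁ a)
      (λ { (false ∷ []) → 1ℂ-positive ; (true ∷ []) → ha }) t B-sepr))
    (sepr-signs₁ a))
  where minor-sign = ¬¬-minor-sign (from-yes (1 ℕ.≤? 3)) B h

Attained⇒∈₂ : ∀ t → Attained t → t ∈ sequences₂
Attained⇒∈₂ t (B , h , B-sepr) = decidable-stable (t ∈? sequences₂) λ t∉ →
  minor-sign (true  ∷ false ∷ []) λ (a , ha) →
  minor-sign (false ∷ true  ∷ []) λ (b , hb) →
  minor-sign (true  ∷ true  ∷ []) λ (p , hp) →
  t∉ (subst (_∈ sequences₂)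
    (sym (HasSepr-unique B (signs₂ a b p) (λ
      { (false ∷ false ∷ []) → 1ℂ-positive
      ; (true  ∷ false ∷ []) → ha
      ; (false ∷ true  ∷ []) → hb
      ; (true  ∷ true  ∷ []) → hp }) t B-sepr))
    (sepr-signs₂ a b p (det₂-constraint
      (det₁-sign a (principal B (true ∷ false ∷ [])) (λ _ _ → h _ _) ha)
      (det₁-sign b (principal B (false ∷ true ∷ [])) (λ _ _ → h _ _) hb)
      (det₂-sign p (principal B (true ∷ true ∷ [])) (λ _ _ → h _ _) hp))))
  where
  minor-sign = ¬¬-minor-sign (from-yes (2 ℕ.≤? 3)) B h
  a′ = re (B zero zero)
  b′ = re (B (suc zero) (suc zero))
  x = B zero (suc zero)
  det₂-constraint : ∀ {a b p} → HasSign a a′ → HasSign b b′ → HasSign p (det₂ a′ b′ x) → p ⊑ a · b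
  det₂-constraint {a} {b} {p} ha hb hp =
    HasSign-mono p (a · b) (det₂ a′ b′ x) (a′ *ℝ b′) (det₂≤product a′ b′ x) hp (HasSign-* a b a′ b′ ha hb)

Attained⇒∈₃ : ∀ t → Attained t → t ∈ sequences₃
Attained⇒∈₃ t (B , h , B-sepr) = decidable-stable (t ∈? sequences₃) λ t∉ →
  minor-sign (true  ∷ false ∷ false ∷ []) λ (a , ha) →
  minor-sign (false ∷ true  ∷ false ∷ []) λ (b , hb) →
  minor-sign (false ∷ false ∷ true  ∷ []) λ (c , hc) →
  minor-sign (true  ∷ true  ∷ false ∷ []) λ (p , hp) →
  minor-sign (true  ∷ false ∷ true  ∷ []) λ (q , hq) →
  minor-sign (false ∷ true  ∷ true  ∷ []) λ (r , hr) →
  minor-sign (true  ∷ true  ∷ true  ∷ []) λ (d , hd) →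
  t∉ (subst (_∈ sequences₃)
    (sym (HasSepr-unique B (signs₃ a b c p q r d) (λ
      { (false ∷ false ∷ false ∷ []) → 1ℂ-positive
      ; (true  ∷ false ∷ false ∷ []) → ha
      ; (false ∷ true  ∷ false ∷ []) → hb
      ; (false ∷ false ∷ true  ∷ []) → hc
      ; (true  ∷ true  ∷ false ∷ []) → hp
      ; (true  ∷ false ∷ true  ∷ []) → hq
      ; (false ∷ true  ∷ true  ∷ []) → hr
      ; (true  ∷ true  ∷ true  ∷ []) → hd }) t B-sepr))
    (sepr-signs₃ a b c p q r d (admissible (re (B i i)) (re (B j j)) (re (B k k)) (B i j) (B i k) (B j k)
      (det₁-sign a (principal B (true  ∷ false ∷ false ∷ [])) (λ _ _ → h _ _) ha)
      (det₁-sign b (principal B (false ∷ true  ∷ false ∷ [])) (λ _ _ → h _ _) hb)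
      (det₁-sign c (principal B (false ∷ false ∷ true  ∷ [])) (λ _ _ → h _ _) hc)
      (det₂-sign p (principal B (true  ∷ true  ∷ false ∷ [])) (λ _ _ → h _ _) hp)
      (det₂-sign q (principal B (true  ∷ false ∷ true  ∷ [])) (λ _ _ → h _ _) hq)
      (det₂-sign r (principal B (false ∷ true  ∷ true  ∷ [])) (λ _ _ → h _ _) hr)
      (det₃-sign d (principal B (true  ∷ true  ∷ true  ∷ [])) (λ _ _ → h _ _) hd))))
  where
  minor-sign = ¬¬-minor-sign ℕ.≤-refl B h
  i = zero
  j = suc zero
  k = suc (suc zero)

-- Rational matrices

-- Sums and products of constant sequences are constant, so a minor of a rational matrix is known
-- from its term at index 0. This makes the signs of the examples computable.
Constantℝ : ℝ → Set
Constantℝ x = ∀ n → seq x n ≡ seq x 0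

Constant : ℂ → Set
Constant z = Constantℝ (re z) × Constantℝ (im z)

+-constant : ∀ {z w} → Constant z → Constant w → Constant (z + w)
+-constant (p , q) (r , s) = (λ n → cong₂ ℚ._+_ (p n) (r n)) , (λ n → cong₂ ℚ._+_ (q n) (s n))

*-constant : ∀ {z w} → Constant z → Constant w → Constant (z * w)
*-constant (p , q) (r , s) =
    (λ n → cong₂ ℚ._-_ (cong₂ ℚ._*_ (p n) (r n)) (cong₂ ℚ._*_ (q n) (s n)))
  , (λ n → cong₂ ℚ._+_ (cong₂ ℚ._*_ (p n) (s n)) (cong₂ ℚ._*_ (q n) (r n)))

alternate-constant : ∀ k z → Constant z → Constant (alternate k z)
alternate-constant zero    z h = h
alternate-constant (suc k) z h = let p , q = alternate-constant k z h in
  (λ n → cong ℚ.-_ (p n)) , (λ n → cong ℚ.-_ (q n))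

∑-constant : ∀ {n} (f : Fin n → ℂ) → (∀ i → Constant (f i)) → Constant (∑ f)
∑-constant {zero}  f h = (λ _ → refl) , (λ _ → refl)
∑-constant {suc n} f h = +-constant {f zero} {∑ (f ∘ suc)} (h zero) (∑-constant (f ∘ suc) (h ∘ suc))

det-constant : ∀ {n} (M : Matrix n) → (∀ i j → Constant (M i j)) → Constant (det M)
det-constant {zero}  M h = (λ _ → refl) , (λ _ → refl)
det-constant {suc n} M h = ∑-constant (λ j → alternate (toℕ j) (term j)) λ j →
  alternate-constant (toℕ j) (term j) (*-constant {M zero j} {det (submatrix j)} (h zero j)
    (det-constant (submatrix j) λ i k → h (suc i) (punchIn j k)))
  where
  submatrix : Fin (suc n) → Matrix n
  submatrix j i k = M (suc i) (punchIn j k)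
  term : Fin (suc n) → ℂ
  term j = M zero j * det (submatrix j)

hermitize-constant : ∀ {n} (M : Matrix n) → (∀ i j → Constant (M i j)) →
  ∀ i j → Constant (hermitize M i j)
hermitize-constant M h zero    zero    = proj₁ (h zero zero) , (λ _ → refl)
hermitize-constant M h zero    (suc j) = h zero (suc j)
hermitize-constant M h (suc i) zero    =
  let p , q = h zero (suc i) in p , (λ n → cong ℚ.-_ (q n))
hermitize-constant M h (suc i) (suc j) =
  hermitize-constant (λ k l → M (suc k) (suc l)) (λ k l → h (suc k) (suc l)) i j

signℚ : ℚ → Sgn
signℚ (mkℚ -[1+ _ ]   _ _) = neg
signℚ (mkℚ (+ zero)   _ _) = zer
signℚ (mkℚ (+ suc _)  _ _) = pos

HasSign-signℚ : ∀ x → Constantℝ x → HasSign (signℚ (seq x 0)) x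
HasSign-signℚ x const with seq x 0
... | q@(mkℚ -[1+ _ ] _ _) = let -q = ℚ.- q in
  -- The margin must lie strictly below every term, hence half of the constant value.
  ½ ℚ.* -q , half-positive (ℚ.positive⁻¹ -q) , 0 , λ n _ →
    subst (½ ℚ.* -q ℚ.<_) (cong ℚ.-_ (sym (const n))) (half< (ℚ.positive⁻¹ -q))
... | q@(mkℚ (+ zero) _ _) = λ ε 0<ε → 0 , λ n _ →
    subst (ℚ._< ε) (trans (sym (cong ℚ.∣_∣ (ℚ.↥p≡0⇒p≡0 q refl))) (cong ℚ.∣_∣ (sym (const n)))) 0<ε
... | q@(mkℚ (+ suc _) _ _) =
  ½ ℚ.* q , half-positive (ℚ.positive⁻¹ q) , 0 , λ n _ →
    subst (½ ℚ.* q ℚ.<_) (sym (const n)) (half< (ℚ.positive⁻¹ q))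

-- Sufficiency of the list

-- The part below the diagonal is ignored.
Entries : ℕ → Set
Entries n = Vec (Vec (ℤ × ℤ) n) n

gaussian : ∀ {n} → Entries n → Matrix n
gaussian A = hermitize λ i j → embed (lookup (lookup A i) j)
  where
  embed : ℤ × ℤ → ℂ
  embed (a , b) = fromℚ (ℚ.fromℤ a) +i fromℚ (ℚ.fromℤ b)

signs : ∀ {n} → Matrix n → Subset n → Sgn
signs B α = signℚ (seq (re (principalMinor B α)) 0)

-- Every table attains whatever sequence is computed from it, so verifying the examples is pure
-- evaluation.
gaussian-attained : ∀ {n} → n ℕ.≤ 3 → (A : Entries n) → Attained (sepr (signs (gaussian A)))
gaussian-attained n≤3 A = B , B-Hermitian , HasSepr-sepr B (signs B) λ α →
  HasSign⇒IsSign (signs B α) (principalMinor B α) (minor-real n≤3 B B-Hermitian α)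
    (HasSign-signℚ (re (principalMinor B α)) (proj₁ (det-constant (principal B α) λ i j →
      hermitize-constant _ (λ _ _ → (λ _ → refl) , (λ _ → refl)) (element α i) (element α j))))
  where
  B = gaussian A
  B-Hermitian = hermitize-Hermitian _

examples⇒Attained : ∀ {n k} → n ℕ.≤ 3 → (As : Vec (Entries n) k) →
  ∀ {t} → t ∈ Vec.map (sepr ∘ signs ∘ gaussian) As → Attained t
examples⇒Attained n≤3 (A ∷ As) (here refl) = gaussian-attained n≤3 A
examples⇒Attained n≤3 (A ∷ As) (there t∈)  = examples⇒Attained n≤3 As t∈

upper₁ : (a : ℤ × ℤ) → Entries 1
upper₁ a = (a ∷ []) ∷ []

upper₂ : (a b x : ℤ × ℤ) → Entries 2
upper₂ a b x = (a ∷ x ∷ []) ∷ (x ∷ b ∷ []) ∷ []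

upper₃ : (a b c x y z : ℤ × ℤ) → Entries 3
upper₃ a b c x y z = (a ∷ x ∷ y ∷ []) ∷ (x ∷ b ∷ z ∷ []) ∷ (y ∷ z ∷ c ∷ []) ∷ []

module GaussianLiterals where
  open FromNat using (fromNat) public
  open FromNeg using (fromNeg) public

  instance
    number : FromNat.Number (ℤ × ℤ)
    number = record { Constraint = λ _ → ⊤ ; fromNat = λ n → + n , ℤ.0ℤ }

    negative : FromNeg.Negative (ℤ × ℤ)
    negative = record { Constraint = λ _ → ⊤ ; fromNeg = λ n → ℤ.- + n , ℤ.0ℤ }

  i : ℤ × ℤ
  i = ℤ.0ℤ , ℤ.1ℤ

examples₁ : Vec (Entries 1) 3
examples₁ = let open GaussianLiterals in
  upper₁  1 ∷
  upper₁ -1 ∷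
  upper₁  0 ∷
  []

examples₂ : Vec (Entries 2) 13
examples₂ = let open GaussianLiterals in
  upper₂  1 -1  0 ∷
  upper₂  1  1  0 ∷
  upper₂  1  1  2 ∷
  upper₂  1  1  1 ∷
  upper₂ -1 -1  0 ∷
  upper₂ -1 -1  2 ∷
  upper₂ -1 -1  1 ∷
  upper₂  0  0  1 ∷
  upper₂  0  0  0 ∷
  upper₂  1  0  1 ∷
  upper₂  1  0  0 ∷
  upper₂  0 -1  1 ∷
  upper₂  0 -1  0 ∷
  []

-- Three operations relate many of these rows: negating the matrix exchanges positive and negative
-- in the odd orders only; changing the sign of a row and its column preserves all minors; changing
-- the sign of `z` alone affects only the term 2 Re (x z ȳ) of the determinant.
examples₃ : Vec (Entries 3) 65
examples₃ = let open GaussianLiterals in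
  upper₃  1 -1 -1  0  0  0 ∷
  upper₃  1  1 -1  0  0  0 ∷
  upper₃  1  1 -1  2  0  0 ∷
  upper₃  1 -1 -1  0  0  2 ∷
  upper₃  1  1  1  0  0  2 ∷
  upper₃  1  1  1  0  0  0 ∷
  upper₃  1  2  2  1  1 -1 ∷
  upper₃  1  1  1  2  2  2 ∷
  upper₃  1  1  1  2  2 -2 ∷
  upper₃ -1 -1 -1  0  0  2 ∷
  upper₃ -1 -2 -2  1  1  1 ∷
  upper₃ -1 -1 -1  0  0  0 ∷
  upper₃ -1 -1 -1  2  2  2 ∷
  upper₃ -1 -1 -1  2  2 -2 ∷
  -- In these five singular examples the third row is plus or minus the sum of the first two.
  upper₃  1 -1  2  1  2  0 ∷
  upper₃  1  1  2  0  1  1 ∷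
  upper₃  1  1  6  2  3  3 ∷
  upper₃ -1 -1 -2  0  1  1 ∷
  upper₃ -1 -1 -6 -2 -3 -3 ∷
  upper₃  1  1  1  1  1 -1 ∷
  upper₃ -1 -1 -1  1  1  1 ∷
  upper₃  1  1  1  1  1  1 ∷
  upper₃ -1 -1 -1  1  1 -1 ∷
  upper₃  1 -1 -1  0  1  1 ∷
  upper₃  1  1 -1  1  0  1 ∷
  upper₃  1  1  1  0  1  2 ∷
  upper₃  1  1  1  0  1  1 ∷
  upper₃  1  1  1  1  1  2 ∷
  upper₃ -1 -1 -1  0  1  2 ∷
  upper₃ -1 -1 -1  0  1  1 ∷
  upper₃ -1 -1 -1  1  1  2 ∷
  upper₃  1  1 -1  1  0  0 ∷
  upper₃  1  1  1  0  0  1 ∷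
  upper₃  1  1  1  1  2  2 ∷
  upper₃ -1 -1 -1  0  0  1 ∷
  upper₃ -1 -1 -1  1  2 -2 ∷
  upper₃  0  0  0  1  1  1 ∷
  upper₃  0  0  0  1  1 -1 ∷
  -- With zero diagonal the determinant is 2 Re (x z ȳ), and all of x, y, z are nonzero when the
  -- minors of order two are negative. Real entries would give 2xyz ≠ 0, so a non-real one is
  -- required.
  upper₃  0  0  0  1  1  i ∷
  upper₃  0  0  0  0  0  0 ∷
  upper₃  0  0  0  0  0  1 ∷
  upper₃  0  1 -1  1  1  1 ∷
  upper₃  0  1 -1  1  2  0 ∷
  upper₃  0  1  1  1  1  0 ∷
  upper₃  0  0  1  1  1  1 ∷
  upper₃  0  0  1  1  1 -1 ∷
  upper₃  0 -1 -1  1  1  0 ∷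
  upper₃  0  0 -1  1  1  1 ∷
  upper₃  0  0 -1  1  1 -1 ∷
  upper₃  0  1 -1  1  1  0 ∷
  upper₃  0  0  1  2  1  1 ∷
  upper₃  0  0 -1  2  1 -1 ∷
  upper₃  0  0  1  0  0  0 ∷
  upper₃  0  0 -1  0  0  0 ∷
  upper₃  0  1 -1  1  0  0 ∷
  upper₃  0  1 -1  0  1  0 ∷
  upper₃  0  1  1  0  1  0 ∷
  upper₃  0  0  1  1  0  0 ∷
  upper₃  0 -1 -1  0  1  0 ∷
  upper₃  0  0 -1  1  0  0 ∷
  upper₃  0  1 -1  0  0  0 ∷
  upper₃  0  1  1  0  0  0 ∷
  upper₃  0  0  1  0  0  1 ∷
  upper₃  0 -1 -1  0  0  0 ∷
  upper₃  0  0 -1  0  0  1 ∷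
  []

-- The examples follow the order of the list, so the two vectors agree by computation.
examples-sepr₁ : sequences₁ ≡ Vec.map (sepr ∘ signs ∘ gaussian) examples₁
examples-sepr₁ = refl

examples-sepr₂ : sequences₂ ≡ Vec.map (sepr ∘ signs ∘ gaussian) examples₂
examples-sepr₂ = refl

examples-sepr₃ : sequences₃ ≡ Vec.map (sepr ∘ signs ∘ gaussian) examples₃
examples-sepr₃ = refl

-- Distinctness of the listed sequences, and the classification

unique? : ∀ {n k} → Decidable (Unique {A = SignSequence n} {k})
unique? = allPairs? λ t u → ¬? (≡-dec _≟_ t u)

mainTheorem3 : (Unique sequences₁ × ((t : SignSequence 1) → Attained t ⇔ t ∈ sequences₁))
    × (Unique sequences₂ × ((t : SignSequence 2) → Attained t ⇔ t ∈ sequences₂))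
    × (Unique sequences₃ × ((t : SignSequence 3) → Attained t ⇔ t ∈ sequences₃))
mainTheorem3 =
    (from-yes (unique? sequences₁) , λ t → mk⇔ (Attained⇒∈₁ t)
      (examples⇒Attained (from-yes (1 ℕ.≤? 3)) examples₁ ∘ subst (t ∈_) examples-sepr₁))
  , (from-yes (unique? sequences₂) , λ t → mk⇔ (Attained⇒∈₂ t)
      (examples⇒Attained (from-yes (2 ℕ.≤? 3)) examples₂ ∘ subst (t ∈_) examples-sepr₂))
  , (from-yes (unique? sequences₃) , λ t → mk⇔ (Attained⇒∈₃ t)
      (examples⇒Attained ℕ.≤-refl examples₃ ∘ subst (t ∈_) examples-sepr₃))
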